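{- Let $p\geq 5$ be a prime, $k\geq 1$ an integer, $q=p^k$, and $G_q=\mathrm{PSL}(2,q)$. Let $H\leq G_q$ be a cyclic subgroup of order $p$, and consider the transitive action of $G_q$ by right multiplication on the set of right cosets of $H$. Then the intersection density of this action is \[ \rho(G_q)=\begin{cases} \dfrac{q}{p} & \text{if } k \text{ is odd},\\[2mm] \dfrac{\sqrt{q}}{p} & \text{if } k \text{ is even},\end{cases} \] where, when $k$ is even, this holds for either of the two conjugacy classes of subgroups of order $p$ in $G_q$ (i.e. whichever cyclic subgroup of order $p$ is chosen as $H$).
   Context: For a finite transitive permutation group $G\leq \mathrm{Sym}(\Omega)$, a subset $\mathcal{F}\subseteq G$ is intersecting if for all $g,h\in\mathcal{F}$ there is $\omega\in\Omega$ with $\omega^g=\omega^h$. The intersection density of $G$ is $\rho(G)=\max\{|\mathcal{F}| : \mathcal{F}\subseteq G \text{ intersecting}\}/(|G|/|\Omega|)$, i.e. the maximum size of an intersecting set divided by the order of a point stabilizer. -}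

module Defs where

open import Data.Nat using (ℕ; zero; suc; _<_; _≤_)
open import Data.Fin using (Fin)
open import Data.Product using (Σ; ∃; ∃-syntax; _×_; _,_)
open import Data.Sum using (_⊎_)
open import Data.List using (List; length)
open import Data.List.Membership.Propositional using (_∈_)
open import Data.List.Relation.Unary.All using (All)
open import Data.List.Relation.Unary.AllPairs using (AllPairs)
open import Relation.Binary.PropositionalEquality using (_≡_)
open import Relation.Nullary using (¬_)
open import Function.Bundles using (_↔_)
open import Algebra.Structures using (IsCommutativeRing)

record Field : Set₁ where
  infixl 7 _*_
  infixl 6 _+_
  field
    Carrier : Set
    _+_ _*_ : Carrier → Carrier → Carrier
    -_      : Carrier → Carrier
    0# 1#   : Carrier
    isCommutativeRing : IsCommutativeRing _≡_ _+_ _*_ -_ 0# 1#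
    0≢1     : ¬ (0# ≡ 1#)
    inverse : ∀ x → ¬ (x ≡ 0#) → ∃[ y ] (x * y ≡ 1#)

HasOrder : Field → ℕ → Set
HasOrder F q = Field.Carrier F ↔ Fin q

-- 2×2 matrices over F.  SL(2,F) = matrices of determinant 1.
-- PSL(2,F) = SL(2,F)/{±I}: its elements are represented by elements
-- of SL(2,F), two representatives denoting the same element of
-- PSL(2,F) iff they agree up to sign (relation _≈_).

module Matrices (F : Field) where
  open Field F

  record Mat : Set where
    constructor mat
    field a b c d : Carrier

  det : Mat → Carrier
  det (mat a b c d) = a * d + - (b * c)

  infixl 7 _·_
  _·_ : Mat → Mat → Mat
  mat a b c d · mat a' b' c' d' =
    mat (a * a' + b * c') (a * b' + b * d') (c * a' + d * c') (c * b' + d * d')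

  neg : Mat → Mat
  neg (mat a b c d) = mat (- a) (- b) (- c) (- d)

  I : Mat
  I = mat 1# 0# 0# 1#

  InSL : Mat → Set
  InSL m = det m ≡ 1#

  infix 4 _≈_
  _≈_ : Mat → Mat → Set
  m ≈ n = (m ≡ n) ⊎ (m ≡ neg n)

  infixr 8 _^_
  _^_ : Mat → ℕ → Mat
  u ^ zero  = I
  u ^ suc n = u · (u ^ n)

  -- (the image in PSL(2,F) of) u has order exactly the prime p,
  -- so H = ⟨u⟩ = {u^i : i < p} is a cyclic subgroup of order p.
  OrderPrime : Mat → ℕ → Set
  OrderPrime u p = InSL u × ¬ (u ≈ I) × ((u ^ p) ≈ I)

  -- Right cosets H y and H z (H = ⟨u⟩, |H| = p) coincide, i.e.
  -- y z⁻¹ ∈ H, i.e. y = h z for some h ∈ H.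
  SameCoset : Mat → ℕ → Mat → Mat → Set
  SameCoset u p y z = ∃[ i ] (i < p × y ≈ (u ^ i) · z)

  -- g and h intersect for the action on right cosets of H:
  -- some point ω = H x (x ∈ G) satisfies ω^g = ω^h, i.e. H x g = H x h.
  Agree : Mat → ℕ → Mat → Mat → Set
  Agree u p g h = ∃[ x ] (InSL x × SameCoset u p (x · g) (x · h))

  IsSubset : List Mat → Set
  IsSubset L = All InSL L × AllPairs (λ g h → ¬ (g ≈ h)) L

  Intersecting : Mat → ℕ → List Mat → Set
  Intersecting u p L = ∀ {g h} → g ∈ L → h ∈ L → Agree u p g h

  IsMaxIntersectingSize : Mat → ℕ → ℕ → Set
  IsMaxIntersectingSize u p m =
    (∃[ L ] (IsSubset L × Intersecting u p L × length L ≡ m)) ×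
    (∀ L → IsSubset L → Intersecting u p L → length L ≤ m)

{-# OPTIONS --safe #-}
module Submission where

-- Elements g and h intersect iff g h⁻¹ is conjugate into H = ⟨u⟩.  Up to conjugation and sign, u is the
-- unitriangular matrix U c₀, and the conjugates of its powers are the I + i c₀ v v^⊥ with i ∈ 𝔽_p.
-- If g = I + Z, h = I + W with Z, W nilpotent of rank one, then g h⁻¹ has trace ±2 iff tr(Z W) ∈ {0, 4}.
-- A Plücker relation between the kernel vectors excludes four nilpotents with pairwise traces 4, so an
-- intersecting set of more than four elements lies in a coset of one Sylow p-subgroup, a copy of (𝔽_q , +).
-- For k odd the prime field contains nonsquares of 𝔽_q, so that all unipotent elements are conjugate into H and
-- the whole Sylow subgroup is intersecting.  For k even every element of 𝔽_p is a square, and the intersecting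
-- sets become the cliques of the Paley graph: for a nonsquare ν the map (x , y) ↦ x + ν y is injective on
-- a clique, hence its size is at most √q, and the subfield of order √q attains the bound.

open import Defs
open import Algebra.Bundles using (CommutativeRing; Semiring)
import Algebra.Properties.Semiring.Binomial as Binomial
import Algebra.Solver.Ring
open import Algebra.Solver.Ring.AlmostCommutativeRing using (fromCommutativeRing; _-Raw-AlmostCommutative⟶_)
open import Data.Empty using (⊥)
open import Data.Fin using (Fin; zero; suc; toℕ; fromℕ; inject₁; punchIn; remQuot; combine)
open import Data.Fin.Patterns using (0F; 1F; 2F; 3F)
import Data.Fin.Permutation as Perm
import Data.Fin.Properties as Fin
open import Data.Integer as ℤ using (ℤ; +_; -[1+_])
import Data.Integer.Properties as ℤ
open import Data.List using (List; []; _∷_; length; filter; tabulate; lookup) renaming (map to mapᴸ)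
open import Data.List.Membership.Propositional using (_∈_)
open import Data.List.Membership.Propositional.Properties
  using (∈-filter⁺; ∈-filter⁻; ∈-lookup; ∈-map⁻; ∈-tabulate⁺)
open import Data.List.Properties using (length-map; length-tabulate)
open import Data.List.Relation.Unary.All as All using (All; []; _∷_)
import Data.List.Relation.Unary.All.Properties as All
open import Data.List.Relation.Unary.AllPairs as AllPairs using (AllPairs; []; _∷_)
import Data.List.Relation.Unary.AllPairs.Properties as AllPairs
open import Data.List.Relation.Unary.Any using (here; there)
open import Data.List.Relation.Unary.Unique.Propositional using (Unique)
import Data.List.Relation.Unary.Unique.Propositional.Properties as Unique
open import Data.Maybe using (Maybe; just; nothing)
open import Data.Nat as ℕ using (ℕ; zero; suc; z≤n; s≤s; _∸_; _!)
open import Data.Nat.Combinatorics using (_C_; k![n∸k]!∣n!; nCn≡1)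
open import Data.Nat.Combinatorics.Specification using (nCk≡n!/k![n-k]!)
open import Data.Nat.Coprimality using (prime⇒coprime; coprime-Bézout)
open import Data.Nat.Divisibility using (_∣_; divides; ∣⇒≤; ∣1⇒≡1; m∣m*n)
open import Data.Nat.DivMod using (m/n*n≡m)
open import Data.Nat.GCD using (module Bézout)
open import Data.Nat.Primality using (Prime; euclidsLemma; prime⇒irreducible; prime⇒nonZero; ¬prime[0]; ¬prime[1])
import Data.Nat.Properties as ℕ
open import Data.Nat.Tactic.RingSolver using (solve-∀)
open import Data.Product using (Σ; ∃; ∃-syntax; _×_; _,_; proj₁; proj₂)
open import Data.Rational.Unnormalised using (mkℚᵘ; _≃_)
import Data.Rational.Unnormalised.Properties as ℚᵘ
open import Data.Sum using (_⊎_; inj₁; inj₂; [_,_]′)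
open import Data.Vec as Vec using (Vec; []; _∷_)
open import Function.Bundles using (Inverse)
open import Level using (0ℓ)
open import Relation.Binary.Definitions using (DecidableEquality; Symmetric; tri<; tri≈; tri>)
open import Relation.Binary.PropositionalEquality as ≡ using (_≡_; _≢_)
open import Relation.Nullary using (Dec; yes; no; ¬_; ¬?; contradiction)
open import Relation.Nullary.Decidable using (map′; decidable-stable; _×-dec_)
open import Relation.Unary using (Decidable)

-- Normal forms over an abstract ring cancel only if equality of the coefficients computes,
-- so the solver is run with coefficients in ℤ.
module IntegerCoefficients (R : CommutativeRing 0ℓ 0ℓ) where
  open CommutativeRing R
  open import Algebra.Properties.Ring ring
  open import Algebra.Properties.Semiring.Mult.TCOptimised semiring renaming (_×_ to _ˣ_)
  open import Relation.Binary.Reasoning.Setoid setoid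
  open import Algebra.Properties.AbelianGroup +-abelianGroup using (⁻¹-∙-comm)
  open import Algebra.Properties.CommutativeSemigroup +-commutativeSemigroup using (interchange)

  fromℤ : ℤ → Carrier
  fromℤ (+ n)    = n ˣ 1#
  fromℤ -[1+ n ] = - (suc n ˣ 1#)

  fromℤ-⊖ : ∀ m n → fromℤ (m ℤ.⊖ n) ≈ m ˣ 1# + - (n ˣ 1#)
  fromℤ-⊖ m zero = sym (trans (+-congˡ -0#≈0#) (+-identityʳ _))
  fromℤ-⊖ zero (suc n) = sym (+-identityˡ _)
  fromℤ-⊖ (suc m) (suc n) = begin
    fromℤ (suc m ℤ.⊖ suc n)                     ≡⟨ ≡.cong fromℤ (ℤ.[1+m]⊖[1+n]≡m⊖n m n) ⟩
    fromℤ (m ℤ.⊖ n)                             ≈⟨ fromℤ-⊖ m n ⟩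
    m ˣ 1# + - (n ˣ 1#)                         ≈⟨ +-identityˡ _ ⟨
    0# + (m ˣ 1# + - (n ˣ 1#))                  ≈⟨ +-congʳ (-‿inverseʳ 1#) ⟨
    (1# + - 1#) + (m ˣ 1# + - (n ˣ 1#))         ≈⟨ interchange _ _ _ _ ⟩
    (1# + m ˣ 1#) + (- 1# + - (n ˣ 1#))         ≈⟨ +-cong (sym (1+× m 1#)) (trans (⁻¹-∙-comm _ _) (-‿cong (sym (1+× n 1#)))) ⟩
    suc m ˣ 1# + - (suc n ˣ 1#)                 ∎

  fromℤ-+ : ∀ i j → fromℤ (i ℤ.+ j) ≈ fromℤ i + fromℤ j
  fromℤ-+ (+ m) (+ n) = ×-homo-+ 1# m n
  fromℤ-+ (+ m) -[1+ n ] = fromℤ-⊖ m (suc n)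
  fromℤ-+ -[1+ m ] (+ n) = trans (fromℤ-⊖ n (suc m)) (+-comm _ _)
  fromℤ-+ -[1+ m ] -[1+ n ] = begin
    - (suc (suc (m ℕ.+ n)) ˣ 1#)            ≡⟨ ≡.cong (λ k → - (suc k ˣ 1#)) (≡.sym (ℕ.+-suc m n)) ⟩
    - ((suc m ℕ.+ suc n) ˣ 1#)              ≈⟨ -‿cong (×-homo-+ 1# (suc m) (suc n)) ⟩
    - (suc m ˣ 1# + suc n ˣ 1#)             ≈⟨ ⁻¹-∙-comm _ _ ⟨
    - (suc m ˣ 1#) + - (suc n ˣ 1#)         ∎

  fromℤ-neg : ∀ i → fromℤ (ℤ.- i) ≈ - fromℤ i
  fromℤ-neg (+ zero) = sym -0#≈0#
  fromℤ-neg (+ suc n) = refl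
  fromℤ-neg -[1+ n ] = sym (-‿involutive _)

  fromℤ-+* : ∀ m j → fromℤ (+ m ℤ.* j) ≈ m ˣ 1# * fromℤ j
  fromℤ-+* m (+ n) = begin
    fromℤ (+ m ℤ.* + n)  ≡⟨ ≡.cong fromℤ (≡.sym (ℤ.pos-* m n)) ⟩
    (m ℕ.* n) ˣ 1#       ≈⟨ ×1-homo-* m n ⟩
    m ˣ 1# * n ˣ 1#      ∎
  fromℤ-+* m -[1+ n ] = begin
    fromℤ (+ m ℤ.* ℤ.- + suc n)  ≡⟨ ≡.cong fromℤ (≡.sym (ℤ.neg-distribʳ-* (+ m) (+ suc n))) ⟩
    fromℤ (ℤ.- (+ m ℤ.* + suc n)) ≈⟨ fromℤ-neg (+ m ℤ.* + suc n) ⟩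
    - fromℤ (+ m ℤ.* + suc n)     ≈⟨ -‿cong (fromℤ-+* m (+ suc n)) ⟩
    - (m ˣ 1# * suc n ˣ 1#)       ≈⟨ -‿distribʳ-* _ _ ⟩
    m ˣ 1# * - (suc n ˣ 1#)       ∎

  fromℤ-* : ∀ i j → fromℤ (i ℤ.* j) ≈ fromℤ i * fromℤ j
  fromℤ-* (+ m) j = fromℤ-+* m j
  fromℤ-* -[1+ m ] j = begin
    fromℤ (ℤ.- + suc m ℤ.* j)     ≡⟨ ≡.cong fromℤ (≡.sym (ℤ.neg-distribˡ-* (+ suc m) j)) ⟩
    fromℤ (ℤ.- (+ suc m ℤ.* j))   ≈⟨ fromℤ-neg (+ suc m ℤ.* j) ⟩
    - fromℤ (+ suc m ℤ.* j)       ≈⟨ -‿cong (fromℤ-+* (suc m) j) ⟩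
    - (suc m ˣ 1# * fromℤ j)      ≈⟨ -‿distribˡ-* _ _ ⟩
    - (suc m ˣ 1#) * fromℤ j      ∎

  ℤ⟶R : ℤ.+-*-rawRing -Raw-AlmostCommutative⟶ fromCommutativeRing R
  ℤ⟶R = record
    { ⟦_⟧    = fromℤ
    ; +-homo = fromℤ-+
    ; *-homo = fromℤ-*
    ; -‿homo = fromℤ-neg
    ; 0-homo = refl
    ; 1-homo = refl
    }

  coefficient≟ : ∀ i j → Maybe (fromℤ i ≈ fromℤ j)
  coefficient≟ i j with i ℤ.≟ j
  ... | yes i≡j = just (reflexive (≡.cong fromℤ i≡j))
  ... | no _    = nothing

  open Algebra.Solver.Ring ℤ.+-*-rawRing (fromCommutativeRing R) ℤ⟶R coefficient≟ public
    using (solve; _:=_; _:+_; _:*_; :-_; _:-_; con)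

prime∤! : ∀ {p} → Prime p → ∀ m → m ℕ.< p → ¬ (p ∣ m !)
prime∤! pr zero m<p p∣1 with ∣1⇒≡1 p∣1
... | ≡.refl = ¬prime[1] pr
prime∤! pr (suc m) m<p p∣ with euclidsLemma (suc m) (m !) pr p∣
... | inj₁ p∣1+m = ℕ.<⇒≱ m<p (∣⇒≤ p∣1+m)
... | inj₂ p∣m!  = prime∤! pr m (ℕ.<⇒≤ m<p) p∣m!

prime∣C : ∀ {p} → Prime p → ∀ k → 0 ℕ.< k → k ℕ.< p → p ∣ p C k
prime∣C {zero} pr k _ _ = contradiction pr ¬prime[0]
prime∣C {p@(suc p-1)} pr k 0<k k<p
  with euclidsLemma (p C k) (k ! ℕ.* (p ∸ k) !) pr p∣C*k!*[p∸k]!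
  where
  instance _ = k ℕ.!* (p ∸ k) !≢0
  C*k!*[p∸k]!≡p! : (p C k) ℕ.* (k ! ℕ.* (p ∸ k) !) ≡ p !
  C*k!*[p∸k]!≡p! = ≡.trans (≡.cong (ℕ._* (k ! ℕ.* (p ∸ k) !)) (nCk≡n!/k![n-k]! (ℕ.<⇒≤ k<p)))
    (m/n*n≡m (k![n∸k]!∣n! (ℕ.<⇒≤ k<p)))
  p∣C*k!*[p∸k]! : p ∣ (p C k) ℕ.* (k ! ℕ.* (p ∸ k) !)
  p∣C*k!*[p∸k]! = ≡.subst (p ∣_) (≡.sym C*k!*[p∸k]!≡p!) (m∣m*n (p-1 !))
... | inj₁ p∣C = p∣C
... | inj₂ p∣k!*[p∸k]! with euclidsLemma (k !) ((p ∸ k) !) pr p∣k!*[p∸k]!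
...   | inj₁ p∣k!     = contradiction p∣k! (prime∤! pr k k<p)
...   | inj₂ p∣[p∸k]! = contradiction p∣[p∸k]! (prime∤! pr (p ∸ k) (ℕ.∸-monoʳ-< 0<k (ℕ.<⇒≤ k<p)))

module Frobenius {a ℓ} (S : Semiring a ℓ) where
  open Semiring S hiding (zero)
  open import Algebra.Properties.Semiring.Mult S renaming (_×_ to _ˣ_)
  open import Algebra.Properties.Semiring.Sum S
  open import Algebra.Properties.Semiring.Exp S
  open import Relation.Binary.Reasoning.Setoid setoid

  frobenius-+ : ∀ {p} → Prime p → (∀ z → p ˣ z ≈ 0#) → ∀ x y → x * y ≈ y * x →
                (x + y) ^ p ≈ x ^ p + y ^ p
  frobenius-+ {zero} pr _ _ _ _ = contradiction pr ¬prime[0]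
  frobenius-+ {p@(suc p-1)} pr p×z≈0 x y xy≈yx = begin
    (x + y) ^ p
      ≈⟨ B.theorem xy≈yx p ⟩
    ∑[ k ≤ p ] B.binomialTerm p k
      ≈⟨ sum-init-last (B.binomialTerm p) ⟩
    (B.binomialTerm p zero + ∑[ i < p-1 ] B.binomialTerm p (inject₁ (suc i))) + B.binomialTerm p (fromℕ p)
      ≈⟨ +-cong (+-cong first (trans (sum-cong-≋ middle) (sum-replicate-zero p-1))) last ⟩
    (y ^ p + 0#) + x ^ p
      ≈⟨ +-congʳ (+-identityʳ _) ⟩
    y ^ p + x ^ p
      ≈⟨ +-comm _ _ ⟩
    x ^ p + y ^ p ∎
    where
    module B = Binomial S x y

    first : B.binomialTerm p zero ≈ y ^ p
    first = trans (×-homo-1 _) (*-identityˡ _)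

    middle : ∀ i → B.binomialTerm p (inject₁ (suc i)) ≈ 0#
    middle i with prime∣C pr (toℕ (inject₁ (suc i))) (ℕ.s≤s ℕ.z≤n)
                    (ℕ.s≤s (≡.subst (ℕ._< p-1) (≡.sym (Fin.toℕ-inject₁ i)) (Fin.toℕ<n i)))
    ... | divides c eq = begin
      (p C toℕ (inject₁ (suc i))) ˣ z  ≡⟨ ≡.cong (_ˣ z) (≡.trans eq (ℕ.*-comm c p)) ⟩
      (p ℕ.* c) ˣ z                    ≈⟨ ×-assocˡ z p c ⟨
      p ˣ (c ˣ z)                      ≈⟨ p×z≈0 _ ⟩
      0#                               ∎
      where z = B.binomial p (inject₁ (suc i))

    last : B.binomialTerm p (fromℕ p) ≈ x ^ p
    last rewrite Fin.toℕ-fromℕ p-1 | nCn≡1 p | ℕ.n∸n≡0 p-1 = trans (×-homo-1 _) (*-identityʳ _)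

length-filter-¬ : ∀ {A : Set} {P : A → Set} (P? : Decidable P) xs →
                  length xs ≡ length (filter P? xs) ℕ.+ length (filter (λ x → ¬? (P? x)) xs)
length-filter-¬ P? [] = ≡.refl
length-filter-¬ P? (x ∷ xs) with P? x
... | yes _ = ≡.cong suc (length-filter-¬ P? xs)
... | no  _ = ≡.trans (≡.cong suc (length-filter-¬ P? xs)) (≡.sym (ℕ.+-suc _ _))

length≤fibres : ∀ {A B : Set} (_≟_ : DecidableEquality B) (f : A → B) {c} →
                (∀ {y zs} → Unique zs → All (λ z → f z ≡ y) zs → length zs ℕ.≤ c) →
                ∀ {xs} ys → Unique xs → (∀ {x} → x ∈ xs → f x ∈ ys) → length xs ℕ.≤ length ys ℕ.* c
length≤fibres _≟_ f small {[]} [] uniq sub = z≤n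
length≤fibres _≟_ f small {x ∷ _} [] uniq sub with () ← sub (here ≡.refl)
length≤fibres _≟_ f {c} small {xs} (y ∷ ys) uniq sub = begin
  length xs
    ≡⟨ length-filter-¬ f≟y xs ⟩
  length (filter f≟y xs) ℕ.+ length (filter (λ x → ¬? (f≟y x)) xs)
    ≤⟨ ℕ.+-mono-≤ (small (Unique.filter⁺ f≟y uniq) (All.all-filter f≟y xs))
         (length≤fibres _≟_ f small ys (Unique.filter⁺ _ uniq) sub′) ⟩
  c ℕ.+ length ys ℕ.* c ∎
  where
  open ℕ.≤-Reasoning
  f≟y : Decidable (λ x → f x ≡ y)
  f≟y x = f x ≟ y
  sub′ : ∀ {x} → x ∈ filter (λ x → ¬? (f≟y x)) xs → f x ∈ ys
  sub′ x∈ with ∈-filter⁻ (λ x → ¬? (f≟y x)) {xs = xs} x∈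
  ... | x∈xs , fx≢y with sub x∈xs
  ...   | here fx≡y = contradiction fx≡y fx≢y
  ...   | there fx∈ys = fx∈ys

module FieldProperties (F : Field) where
  open Field F public

  commutativeRing : CommutativeRing 0ℓ 0ℓ
  commutativeRing = record { isCommutativeRing = isCommutativeRing }

  open CommutativeRing commutativeRing public
    using (+-assoc; +-comm; +-identityˡ; +-identityʳ; -‿inverseˡ; -‿inverseʳ;
           *-assoc; *-comm; *-identityˡ; *-identityʳ; zeroˡ; zeroʳ; _-_;
           semiring; commutativeSemiring; +-commutativeMonoid; *-commutativeMonoid; ring)
  open IntegerCoefficients commutativeRing public
    using (solve; _:=_; _:+_; _:*_; :-_; _:-_; con)
  open import Algebra.Properties.Semiring.Exp semiring public
    using (_^_; ^-homo-*; ^-assocʳ)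
  open import Algebra.Properties.CommutativeSemiring.Exp commutativeSemiring public
    using (^-distrib-*)
  open import Algebra.Properties.Semiring.Mult semiring public
    using () renaming (_×_ to _ˣ_; ×-homo-+ to ˣ-homo-+; ×1-homo-* to ˣ1-homo-*; ×-assoc-* to ˣ-assoc-*)
  open ≡.≡-Reasoning

  1≢0 : 1# ≢ 0#
  1≢0 1≡0 = 0≢1 (≡.sym 1≡0)

  *-cancelˡ : ∀ {x y z} → x ≢ 0# → x * y ≡ x * z → y ≡ z
  *-cancelˡ {x} {y} {z} x≢0 xy≡xz with w , xw≡1 ← inverse x x≢0 = begin
    y             ≡⟨ expand y ⟩
    w * (x * y)   ≡⟨ ≡.cong (w *_) xy≡xz ⟩
    w * (x * z)   ≡⟨ expand z ⟨
    z             ∎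
    where
    expand : ∀ y → y ≡ w * (x * y)
    expand y = begin
      y            ≡⟨ *-identityˡ y ⟨
      1# * y       ≡⟨ ≡.cong (_* y) xw≡1 ⟨
      x * w * y    ≡⟨ solve 3 (λ x w y → x :* w :* y := w :* (x :* y)) ≡.refl x w y ⟩
      w * (x * y)  ∎

  x*y≡0⇒y≡0 : ∀ {x y} → x ≢ 0# → x * y ≡ 0# → y ≡ 0#
  x*y≡0⇒y≡0 {x} x≢0 xy≡0 = *-cancelˡ x≢0 (≡.trans xy≡0 (≡.sym (zeroʳ x)))

  *-≢0 : ∀ {x y} → x ≢ 0# → y ≢ 0# → x * y ≢ 0#
  *-≢0 x≢0 y≢0 xy≡0 = y≢0 (x*y≡0⇒y≡0 x≢0 xy≡0)

  x²≢0⇒x≢0 : ∀ {x y} → x * x ≡ y → y ≢ 0# → x ≢ 0#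
  x²≢0⇒x≢0 {x} x²≡y y≢0 x≡0 = y≢0 (≡.trans (≡.sym x²≡y) (≡.trans (≡.cong (_* x) x≡0) (zeroˡ x)))

  xy≡1⇒y≢0 : ∀ {x y} → x * y ≡ 1# → y ≢ 0#
  xy≡1⇒y≢0 {x} xy≡1 y≡0 = 1≢0 (≡.trans (≡.sym xy≡1) (≡.trans (≡.cong (x *_) y≡0) (zeroʳ x)))

  ^-≢0 : ∀ {x} n → x ≢ 0# → x ^ n ≢ 0#
  ^-≢0 zero x≢0 = 1≢0
  ^-≢0 (suc n) x≢0 = *-≢0 x≢0 (^-≢0 n x≢0)

  1^n≡1 : ∀ n → 1# ^ n ≡ 1#
  1^n≡1 zero = ≡.refl
  1^n≡1 (suc n) = ≡.trans (*-identityˡ _) (1^n≡1 n)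

  -‿≡0⇒≡ : ∀ {x y} → x - y ≡ 0# → x ≡ y
  -‿≡0⇒≡ {x} {y} x-y≡0 = begin
    x            ≡⟨ solve 2 (λ x y → x := (x :- y) :+ y) ≡.refl x y ⟩
    (x - y) + y  ≡⟨ ≡.cong (_+ y) x-y≡0 ⟩
    0# + y       ≡⟨ +-identityˡ y ⟩
    y            ∎

  ≡⇒-‿≡0 : ∀ {x y} → x ≡ y → x - y ≡ 0#
  ≡⇒-‿≡0 {x} ≡.refl = -‿inverseʳ x

  -- The value at x of the monic polynomial of degree n whose lower coefficients, constant term first, are cs.
  monic : ∀ {n} → Vec Carrier n → Carrier → Carrier
  monic [] x = 1#
  monic (c ∷ cs) x = c + x * monic cs x

  quotient : ∀ {n} → Carrier → Vec Carrier (suc n) → Vec Carrier n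
  quotient a (c ∷ []) = []
  quotient a (c ∷ cs@(_ ∷ _)) = monic cs a ∷ quotient a cs

  monic-quotient : ∀ {n} a (cs : Vec Carrier (suc n)) x →
                   monic cs x - monic cs a ≡ (x - a) * monic (quotient a cs) x
  monic-quotient a (c ∷ []) x =
    solve 3 (λ a c x → (c :+ x :* con (+ 1)) :- (c :+ a :* con (+ 1)) := (x :- a) :* con (+ 1)) ≡.refl a c x
  monic-quotient a (c ∷ cs@(_ ∷ _)) x = begin
    (c + x * P) - (c + a * Q)
      ≡⟨ solve 5 (λ a c x P Q → (c :+ x :* P) :- (c :+ a :* Q) := (x :- a) :* Q :+ x :* (P :- Q)) ≡.refl a c x P Q ⟩
    (x - a) * Q + x * (P - Q)
      ≡⟨ ≡.cong (λ z → (x - a) * Q + x * z) (monic-quotient a cs x) ⟩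
    (x - a) * Q + x * ((x - a) * D)
      ≡⟨ solve 4 (λ a x Q D → (x :- a) :* Q :+ x :* ((x :- a) :* D) := (x :- a) :* (Q :+ x :* D)) ≡.refl a x Q D ⟩
    (x - a) * (Q + x * D) ∎
    where
    P = monic cs x
    Q = monic cs a
    D = monic (quotient a cs) x

  length-roots≤degree : ∀ {n} (cs : Vec Carrier n) {xs} → Unique xs →
                        All (λ x → monic cs x ≡ 0#) xs → length xs ℕ.≤ n
  length-roots≤degree cs [] [] = z≤n
  length-roots≤degree [] (_ ∷ _) (1≡0 ∷ _) = contradiction 1≡0 1≢0
  length-roots≤degree cs@(_ ∷ _) {a ∷ xs} (a∉xs ∷ uniq) (Pa≡0 ∷ roots) =
    s≤s (length-roots≤degree (quotient a cs) uniq
      (All.zipWith (λ (a≢x , Px≡0) → root a≢x Px≡0) (a∉xs , roots)))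
    where
    root : ∀ {x} → a ≢ x → monic cs x ≡ 0# → monic (quotient a cs) x ≡ 0#
    root {x} a≢x Px≡0 = x*y≡0⇒y≡0 (λ x-a≡0 → a≢x (≡.sym (-‿≡0⇒≡ x-a≡0))) (begin
      (x - a) * monic (quotient a cs) x  ≡⟨ monic-quotient a cs x ⟨
      monic cs x - monic cs a            ≡⟨ ≡⇒-‿≡0 (≡.trans Px≡0 (≡.sym Pa≡0)) ⟩
      0#                                 ∎)

  monic-replicate-0 : ∀ n x → monic (Vec.replicate n 0#) x ≡ x ^ n
  monic-replicate-0 zero x = ≡.refl
  monic-replicate-0 (suc n) x = ≡.trans (+-identityˡ _) (≡.cong (x *_) (monic-replicate-0 n x))

  length-nthRoots≤n : ∀ n .{{_ : ℕ.NonZero n}} {c xs} → Unique xs → All (λ x → x ^ n ≡ c) xs → length xs ℕ.≤ n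
  length-nthRoots≤n (suc n) {c} uniq roots =
    length-roots≤degree (- c ∷ Vec.replicate n 0#) uniq (All.map (λ {x} → root {x}) roots)
    where
    root : ∀ {x} → x ^ suc n ≡ c → - c + x * monic (Vec.replicate n 0#) x ≡ 0#
    root {x} x^≡c = begin
      - c + x * monic (Vec.replicate n 0#) x  ≡⟨ ≡.cong (λ z → - c + x * z) (monic-replicate-0 n x) ⟩
      - c + x ^ suc n                         ≡⟨ ≡.cong (λ z → - c + z) x^≡c ⟩
      - c + c                                 ≡⟨ -‿inverseˡ c ⟩
      0#                                      ∎

-- The order is written 1 + n, so that n is the order of the multiplicative group.
module FiniteField (F : Field) {n : ℕ} (F↔Fin : HasOrder F (suc n)) where
  open FieldProperties F public
  open Inverse F↔Fin public using () renaming (to to index; from to element)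

  element-index : ∀ x → element (index x) ≡ x
  element-index x = Inverse.strictlyInverseʳ F↔Fin x

  index-element : ∀ i → index (element i) ≡ i
  index-element i = Inverse.strictlyInverseˡ F↔Fin i

  index-injective : ∀ {x y} → index x ≡ index y → x ≡ y
  index-injective {x} {y} eq = ≡.trans (≡.sym (element-index x)) (≡.trans (≡.cong element eq) (element-index y))

  element-injective : ∀ {i j} → element i ≡ element j → i ≡ j
  element-injective {i} {j} eq = ≡.trans (≡.sym (index-element i)) (≡.trans (≡.cong index eq) (index-element j))

  infix 4 _≟_
  _≟_ : DecidableEquality Carrier
  x ≟ y = map′ index-injective (≡.cong index) (index x Fin.≟ index y)

  any? : ∀ {P : Carrier → Set} → Decidable P → Dec (∃ P)
  any? {P} P? = map′ (λ (i , p) → element i , p) (λ (x , p) → index x , ≡.subst P (≡.sym (element-index x)) p)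
                  (Fin.any? (λ i → P? (element i)))

  elements : List Carrier
  elements = tabulate element

  elements-unique : Unique elements
  elements-unique = Unique.tabulate⁺ element-injective

  ∈-elements : ∀ x → x ∈ elements
  ∈-elements x = ≡.subst (_∈ elements) (element-index x) (∈-tabulate⁺ {f = element} (index x))

  nonzero? : Decidable (_≢ 0#)
  nonzero? x = ¬? (x ≟ 0#)

  n≤length-nonzero : n ℕ.≤ length (filter nonzero? elements)
  n≤length-nonzero = ℕ.+-cancelˡ-≤ 1 _ _ (begin
    suc n                                    ≡⟨ length-tabulate element ⟨
    length elements                          ≡⟨ length-filter-¬ (_≟ 0#) elements ⟩
    length zeros ℕ.+ length nonzeros         ≤⟨ ℕ.+-monoˡ-≤ (length nonzeros) length-zeros≤1 ⟩
    1 ℕ.+ length nonzeros                    ∎)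
    where
    open ℕ.≤-Reasoning
    zeros = filter (_≟ 0#) elements
    nonzeros = filter nonzero? elements
    length-zeros≤1 : length zeros ℕ.≤ 1
    length-zeros≤1 = length-nthRoots≤n 1 (Unique.filter⁺ (_≟ 0#) elements-unique)
      (All.map (λ {x} x≡0 → ≡.trans (*-identityʳ x) x≡0) (All.all-filter (_≟ 0#) elements))

  permutation : (f g : Carrier → Carrier) → (∀ x → f (g x) ≡ x) → (∀ x → g (f x) ≡ x) → Perm.Permutation′ (suc n)
  permutation f g fg gf = Perm.permutation (λ i → index (f (element i))) (λ i → index (g (element i)))
    (λ i → inv f g fg i) (λ i → inv g f gf i)
    where
    inv : (f g : Carrier → Carrier) → (∀ x → f (g x) ≡ x) → ∀ i → index (f (element (index (g (element i))))) ≡ i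
    inv f g fg i = ≡.trans (≡.cong (λ z → index (f z)) (element-index _)) (≡.trans (≡.cong index (fg _)) (index-element i))

  order×1≡0 : suc n ˣ 1# ≡ 0#
  order×1≡0 = begin
    m                ≡⟨ solve 2 (λ m S → m := (S :+ m) :- S) ≡.refl m S ⟩
    (S + m) - S      ≡⟨ ≡⇒-‿≡0 (≡.sym S≡S+m) ⟩
    0#               ∎
    where
    open ≡.≡-Reasoning
    open import Algebra.Properties.CommutativeMonoid.Sum +-commutativeMonoid
    m = suc n ˣ 1#
    S = sum element
    π = permutation (_+ 1#) (_+ - 1#)
          (λ x → solve 1 (λ x → x :+ :- con (+ 1) :+ con (+ 1) := x) ≡.refl x)
          (λ x → solve 1 (λ x → x :+ con (+ 1) :+ :- con (+ 1) := x) ≡.refl x)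
    S≡S+m : S ≡ S + m
    S≡S+m = begin
      sum element                                  ≡⟨ sum-permute element π ⟩
      sum (λ i → element (index (element i + 1#))) ≡⟨ sum-cong-≋ (λ i → element-index (element i + 1#)) ⟩
      sum (λ i → element i + 1#)                   ≡⟨ ∑-distrib-+ element (λ _ → 1#) ⟩
      S + sum {suc n} (λ _ → 1#)                   ≡⟨ ≡.cong (λ z → S + z) (sum-replicate (suc n)) ⟩
      S + m                                        ∎

  characteristic : ∀ p k → suc n ≡ p ℕ.^ k → p ˣ 1# ≡ 0#
  characteristic p k q≡p^k with p ˣ 1# ≟ 0#
  ... | yes eq = eq
  ... | no p≢0 = contradiction (≡.trans (≡.cong (_ˣ 1#) (≡.sym q≡p^k)) order×1≡0) (p^j≢0 k)
    where
    p^j≢0 : ∀ j → (p ℕ.^ j) ˣ 1# ≢ 0#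
    p^j≢0 zero eq = 1≢0 (≡.trans (≡.sym (+-identityʳ 1#)) eq)
    p^j≢0 (suc j) eq = *-≢0 p≢0 (p^j≢0 j) (≡.trans (≡.sym (ˣ1-homo-* p (p ℕ.^ j))) eq)

  -- Multiplication by x permutes the field; compare the products of the nonzero elements, 0# being replaced by 1#.
  fermat : ∀ {x} → x ≢ 0# → x ^ n ≡ 1#
  fermat {x} x≢0 with w , xw≡1 ← inverse x x≢0 = *-cancelˡ (product≢0 (λ i → g≢0 (element i))) (begin
    P * x ^ n     ≡⟨ ≡.cong (P *_) product-h ⟨
    P * sum h     ≡⟨ ∑-distrib-+ (λ i → g (element i)) h ⟨
    sum (λ i → g (element i) * h i)  ≡⟨ sum-cong-≋ (λ i → gh (element i)) ⟩
    sum (λ i → g (x * element i))    ≡⟨ sum-cong-≋ (λ i → ≡.cong g (≡.sym (element-index (x * element i)))) ⟩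
    sum (λ i → g (element (index (x * element i)))) ≡⟨ sum-permute (λ i → g (element i)) π ⟨
    P             ≡⟨ *-identityʳ P ⟨
    P * 1#        ∎)
    where
    open ≡.≡-Reasoning
    open import Algebra.Properties.CommutativeMonoid.Sum *-commutativeMonoid
    g : Carrier → Carrier
    g y with y ≟ 0#
    ... | yes _ = 1#
    ... | no  _ = y
    h′ : Carrier → Carrier
    h′ y with y ≟ 0#
    ... | yes _ = 1#
    ... | no  _ = x
    h : Fin (suc n) → Carrier
    h i = h′ (element i)
    P = sum (λ i → g (element i))

    g≢0 : ∀ y → g y ≢ 0#
    g≢0 y with y ≟ 0#
    ... | yes _ = 1≢0
    ... | no y≢0 = y≢0

    product≢0 : ∀ {m} {t : Fin m → Carrier} → (∀ i → t i ≢ 0#) → sum t ≢ 0#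
    product≢0 {zero} _ = 1≢0
    product≢0 {suc m} t≢0 = *-≢0 (t≢0 zero) (product≢0 (λ i → t≢0 (suc i)))

    gh : ∀ y → g y * h′ y ≡ g (x * y)
    gh y with y ≟ 0# | x * y ≟ 0#
    ... | yes _     | yes _ = *-identityˡ 1#
    ... | yes y≡0   | no xy≢0 = contradiction (≡.trans (≡.cong (x *_) y≡0) (zeroʳ x)) xy≢0
    ... | no y≢0    | yes xy≡0 = contradiction xy≡0 (*-≢0 x≢0 y≢0)
    ... | no _      | no _ = *-comm y x

    h′-≢0 : ∀ y → y ≢ 0# → h′ y ≡ x
    h′-≢0 y y≢0 with y ≟ 0#
    ... | yes y≡0 = contradiction y≡0 y≢0
    ... | no _ = ≡.refl

    h′-≡0 : ∀ y → y ≡ 0# → h′ y ≡ 1#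
    h′-≡0 y y≡0 with y ≟ 0#
    ... | yes _ = ≡.refl
    ... | no y≢0 = contradiction y≡0 y≢0

    product-h : sum h ≡ x ^ n
    product-h = begin
      sum h
        ≡⟨ sum-remove {i = index 0#} h ⟩
      h (index 0#) * sum (λ j → h (punchIn (index 0#) j))
        ≡⟨ ≡.cong₂ _*_ (h′-≡0 _ (element-index 0#)) (sum-cong-≋ (λ j → h′-≢0 _ (λ eq → Fin.punchInᵢ≢i (index 0#) j
             (≡.trans (≡.sym (index-element _)) (≡.cong index eq))))) ⟩
      1# * sum {n} (λ _ → x)
        ≡⟨ *-identityˡ _ ⟩
      sum {n} (λ _ → x)
        ≡⟨ sum-replicate n ⟩
      x ^ n ∎

    cancel : ∀ a b → a * b ≡ 1# → ∀ y → a * (b * y) ≡ y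
    cancel a b ab≡1 y = ≡.trans (≡.sym (*-assoc a b y)) (≡.trans (≡.cong (_* y) ab≡1) (*-identityˡ y))

    π = permutation (x *_) (w *_) (cancel x w xw≡1) (cancel w x (≡.trans (*-comm w x) xw≡1))

  module PowerMap (a b : ℕ) .{{_ : ℕ.NonZero a}} .{{_ : ℕ.NonZero b}} (b*a≡n : b ℕ.* a ≡ n) where

    private
      [y^a]^b≡1 : ∀ {y} → y ≢ 0# → (y ^ a) ^ b ≡ 1#
      [y^a]^b≡1 {y} y≢0 = ≡.trans (^-assocʳ y a b) (≡.trans (≡.cong (y ^_) (≡.trans (ℕ.*-comm a b) b*a≡n)) (fermat y≢0))

      b≤length : ∀ ys → (∀ {y} → y ≢ 0# → y ^ a ∈ ys) → b ℕ.≤ length ys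
      b≤length ys sub = ℕ.*-cancelʳ-≤ b (length ys) a (begin
        b ℕ.* a                              ≡⟨ b*a≡n ⟩
        n                                    ≤⟨ n≤length-nonzero ⟩
        length (filter nonzero? elements)    ≤⟨ length≤fibres _≟_ (_^ a) (λ uniq → length-nthRoots≤n a uniq) ys
                                                  (Unique.filter⁺ nonzero? elements-unique)
                                                  (λ x∈ → sub (proj₂ (∈-filter⁻ nonzero? {xs = elements} x∈))) ⟩
        length ys ℕ.* a ∎)
        where open ℕ.≤-Reasoning

    root? : Decidable (λ x → x ^ b ≡ 1#)
    root? x = x ^ b ≟ 1#

    rootsOfUnity : List Carrier
    rootsOfUnity = filter root? elements

    rootsOfUnity-unique : Unique rootsOfUnity
    rootsOfUnity-unique = Unique.filter⁺ root? elements-unique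

    rootsOfUnity-all : All (λ x → x ^ b ≡ 1#) rootsOfUnity
    rootsOfUnity-all = All.all-filter root? elements

    length-rootsOfUnity : length rootsOfUnity ≡ b
    length-rootsOfUnity = ℕ.≤-antisym (length-nthRoots≤n b rootsOfUnity-unique rootsOfUnity-all)
      (b≤length rootsOfUnity (λ y≢0 → ∈-filter⁺ root? (∈-elements _) ([y^a]^b≡1 y≢0)))

    x^b≡1⇒power : ∀ {x} → x ^ b ≡ 1# → ∃[ y ] y ^ a ≡ x
    x^b≡1⇒power {x} x^b≡1 with any? (λ y → y ^ a ≟ x)
    ... | yes power = power
    ... | no notPower = contradiction (length-nthRoots≤n b {xs = x ∷ others}
            (All.map (λ y≢x x≡y → y≢x (≡.sym x≡y)) (All.all-filter ≢x? rootsOfUnity) ∷ Unique.filter⁺ ≢x? rootsOfUnity-unique)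
            (x^b≡1 ∷ All.tabulate (λ y∈ → All.lookup rootsOfUnity-all (proj₁ (∈-filter⁻ ≢x? {xs = rootsOfUnity} y∈)))))
          (ℕ.≤⇒≯ (b≤length others λ {y} y≢0 →
            ∈-filter⁺ ≢x? (∈-filter⁺ root? (∈-elements _) ([y^a]^b≡1 y≢0)) (λ y^a≡x → notPower (y , y^a≡x))))
      where
      ≢x? = λ y → ¬? (y ≟ x)
      others = filter ≢x? rootsOfUnity

module MatrixProperties (F : Field) where
  open FieldProperties F
  open Matrices F public renaming (_^_ to _^ᴹ_)

  2# : Carrier
  2# = 1# + 1#

  mat-cong : ∀ {a b c d a′ b′ c′ d′} → a ≡ a′ → b ≡ b′ → c ≡ c′ → d ≡ d′ → mat a b c d ≡ mat a′ b′ c′ d′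
  mat-cong ≡.refl ≡.refl ≡.refl ≡.refl = ≡.refl

  infixl 6 _⊕_
  _⊕_ : Mat → Mat → Mat
  mat a b c d ⊕ mat a′ b′ c′ d′ = mat (a + a′) (b + b′) (c + c′) (d + d′)

  𝟎 : Mat
  𝟎 = mat 0# 0# 0# 0#

  ·-assoc : ∀ x y z → (x · y) · z ≡ x · (y · z)
  ·-assoc (mat a b c d) (mat e f g h) (mat i j k l) =
    mat-cong (entry a b i k) (entry a b j l) (entry c d i k) (entry c d j l)
    where
    entry : ∀ a b i k → (a * e + b * g) * i + (a * f + b * h) * k ≡ a * (e * i + f * k) + b * (g * i + h * k)
    entry a b i k = solve 8 (λ a b e f g h i k →
      (a :* e :+ b :* g) :* i :+ (a :* f :+ b :* h) :* k := a :* (e :* i :+ f :* k) :+ b :* (g :* i :+ h :* k))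
      ≡.refl a b e f g h i k

  private
    1a+0b : ∀ a b → 1# * a + 0# * b ≡ a
    1a+0b = solve 2 (λ a b → con (+ 1) :* a :+ con (+ 0) :* b := a) ≡.refl

    0a+1b : ∀ a b → 0# * a + 1# * b ≡ b
    0a+1b = solve 2 (λ a b → con (+ 0) :* a :+ con (+ 1) :* b := b) ≡.refl

    a1+b0 : ∀ a b → a * 1# + b * 0# ≡ a
    a1+b0 = solve 2 (λ a b → a :* con (+ 1) :+ b :* con (+ 0) := a) ≡.refl

    a0+b1 : ∀ a b → a * 0# + b * 1# ≡ b
    a0+b1 = solve 2 (λ a b → a :* con (+ 0) :+ b :* con (+ 1) := b) ≡.refl

    0a+0b : ∀ a b → 0# * a + 0# * b ≡ 0#
    0a+0b = solve 2 (λ a b → con (+ 0) :* a :+ con (+ 0) :* b := con (+ 0)) ≡.refl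

    a0+b0 : ∀ a b → a * 0# + b * 0# ≡ 0#
    a0+b0 = solve 2 (λ a b → a :* con (+ 0) :+ b :* con (+ 0) := con (+ 0)) ≡.refl

    distribute : ∀ a b e f g h → a * (e + f) + b * (g + h) ≡ (a * e + b * g) + (a * f + b * h)
    distribute = solve 6 (λ a b e f g h →
      a :* (e :+ f) :+ b :* (g :+ h) := (a :* e :+ b :* g) :+ (a :* f :+ b :* h)) ≡.refl

    distribute′ : ∀ a b e f g h → (e + f) * a + (g + h) * b ≡ (e * a + g * b) + (f * a + h * b)
    distribute′ = solve 6 (λ a b e f g h →
      (e :+ f) :* a :+ (g :+ h) :* b := (e :* a :+ g :* b) :+ (f :* a :+ h :* b)) ≡.refl

  ·-identityˡ : ∀ x → I · x ≡ x
  ·-identityˡ (mat a b c d) = mat-cong (1a+0b a c) (1a+0b b d) (0a+1b a c) (0a+1b b d)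

  ·-identityʳ : ∀ x → x · I ≡ x
  ·-identityʳ (mat a b c d) = mat-cong (a1+b0 a b) (a0+b1 a b) (a1+b0 c d) (a0+b1 c d)

  matSemiring : Semiring 0ℓ 0ℓ
  matSemiring = record
    { Carrier = Mat ; _≈_ = _≡_ ; _+_ = _⊕_ ; _*_ = _·_ ; 0# = 𝟎 ; 1# = I
    ; isSemiring = record
      { isSemiringWithoutAnnihilatingZero = record
        { +-isCommutativeMonoid = record
          { isMonoid = record
            { isSemigroup = record
              { isMagma = record { isEquivalence = ≡.isEquivalence ; ∙-cong = ≡.cong₂ _⊕_ }
              ; assoc = λ { (mat a b c d) (mat e f g h) (mat i j k l) →
                  mat-cong (+-assoc a e i) (+-assoc b f j) (+-assoc c g k) (+-assoc d h l) }
              }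
            ; identity = (λ { (mat a b c d) → mat-cong (+-identityˡ a) (+-identityˡ b) (+-identityˡ c) (+-identityˡ d) })
                       , (λ { (mat a b c d) → mat-cong (+-identityʳ a) (+-identityʳ b) (+-identityʳ c) (+-identityʳ d) })
            }
          ; comm = λ { (mat a b c d) (mat e f g h) → mat-cong (+-comm a e) (+-comm b f) (+-comm c g) (+-comm d h) }
          }
        ; *-cong = ≡.cong₂ _·_
        ; *-assoc = ·-assoc
        ; *-identity = ·-identityˡ , ·-identityʳ
        ; distrib = (λ { (mat a b c d) (mat e f g h) (mat i j k l) → mat-cong
                      (distribute a b e i g k) (distribute a b f j h l) (distribute c d e i g k) (distribute c d f j h l) })
                  , (λ { (mat a b c d) (mat e f g h) (mat i j k l) → mat-cong
                      (distribute′ a c e i f j) (distribute′ b d e i f j) (distribute′ a c g k h l) (distribute′ b d g k h l) })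
        }
      ; zero = (λ { (mat a b c d) → mat-cong (0a+0b a c) (0a+0b b d) (0a+0b a c) (0a+0b b d) })
             , (λ { (mat a b c d) → mat-cong (a0+b0 a b) (a0+b0 a b) (a0+b0 c d) (a0+b0 c d) })
      }
    }

  det-· : ∀ x y → det (x · y) ≡ det x * det y
  det-· (mat a b c d) (mat e f g h) = solve 8 (λ a b c d e f g h →
    (a :* e :+ b :* g) :* (c :* f :+ d :* h) :+ :- ((a :* f :+ b :* h) :* (c :* e :+ d :* g)) :=
    (a :* d :+ :- (b :* c)) :* (e :* h :+ :- (f :* g))) ≡.refl a b c d e f g h

  det-I : InSL I
  det-I = solve 0 (con (+ 1) :* con (+ 1) :+ :- (con (+ 0) :* con (+ 0)) := con (+ 1)) ≡.refl

  InSL-· : ∀ {x y} → InSL x → InSL y → InSL (x · y)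
  InSL-· {x} {y} dx dy = ≡.trans (det-· x y) (≡.trans (≡.cong₂ _*_ dx dy) (*-identityˡ 1#))

  adj : Mat → Mat
  adj (mat a b c d) = mat d (- b) (- c) a

  adj-inverseˡ : ∀ {x} → InSL x → adj x · x ≡ I
  adj-inverseˡ {mat a b c d} ad-bc≡1 = mat-cong
    (≡.trans (solve 4 (λ a b c d → d :* a :+ :- b :* c := a :* d :+ :- (b :* c)) ≡.refl a b c d) ad-bc≡1)
    (solve 2 (λ b d → d :* b :+ :- b :* d := con (+ 0)) ≡.refl b d)
    (solve 2 (λ a c → :- c :* a :+ a :* c := con (+ 0)) ≡.refl a c)
    (≡.trans (solve 4 (λ a b c d → :- c :* b :+ a :* d := a :* d :+ :- (b :* c)) ≡.refl a b c d) ad-bc≡1)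

  adj-inverseʳ : ∀ {x} → InSL x → x · adj x ≡ I
  adj-inverseʳ {mat a b c d} ad-bc≡1 = mat-cong
    (≡.trans (solve 4 (λ a b c d → a :* d :+ b :* :- c := a :* d :+ :- (b :* c)) ≡.refl a b c d) ad-bc≡1)
    (solve 2 (λ a b → a :* :- b :+ b :* a := con (+ 0)) ≡.refl a b)
    (solve 2 (λ c d → c :* d :+ d :* :- c := con (+ 0)) ≡.refl c d)
    (≡.trans (solve 4 (λ a b c d → c :* :- b :+ d :* a := a :* d :+ :- (b :* c)) ≡.refl a b c d) ad-bc≡1)

  InSL-adj : ∀ {x} → InSL x → InSL (adj x)
  InSL-adj {mat a b c d} = ≡.trans
    (solve 4 (λ a b c d → d :* a :+ :- (:- b :* :- c) := a :* d :+ :- (b :* c)) ≡.refl a b c d)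

  private
    -‿involutive : ∀ a → - (- a) ≡ a
    -‿involutive = solve 1 (λ a → :- (:- a) := a) ≡.refl

  neg-involutive : ∀ x → neg (neg x) ≡ x
  neg-involutive (mat a b c d) = mat-cong (-‿involutive a) (-‿involutive b) (-‿involutive c) (-‿involutive d)

  neg-·ˡ : ∀ x y → neg x · y ≡ neg (x · y)
  neg-·ˡ (mat a b c d) (mat e f g h) = mat-cong (entry a b e g) (entry a b f h) (entry c d e g) (entry c d f h)
    where
    entry : ∀ a b e g → - a * e + - b * g ≡ - (a * e + b * g)
    entry = solve 4 (λ a b e g → :- a :* e :+ :- b :* g := :- (a :* e :+ b :* g)) ≡.refl

  neg-·ʳ : ∀ x y → x · neg y ≡ neg (x · y)
  neg-·ʳ (mat a b c d) (mat e f g h) = mat-cong (entry a b e g) (entry a b f h) (entry c d e g) (entry c d f h)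
    where
    entry : ∀ a b e g → a * - e + b * - g ≡ - (a * e + b * g)
    entry = solve 4 (λ a b e g → a :* :- e :+ b :* :- g := :- (a :* e :+ b :* g)) ≡.refl

  det-neg : ∀ x → det (neg x) ≡ det x
  det-neg (mat a b c d) = solve 4 (λ a b c d → :- a :* :- d :+ :- (:- b :* :- c) := a :* d :+ :- (b :* c)) ≡.refl a b c d

  ≈-reflexive : ∀ {x y} → x ≡ y → x ≈ y
  ≈-reflexive = inj₁

  ≈-sym : ∀ {x y} → x ≈ y → y ≈ x
  ≈-sym (inj₁ x≡y) = inj₁ (≡.sym x≡y)
  ≈-sym (inj₂ x≡-y) = inj₂ (≡.trans (≡.sym (neg-involutive _)) (≡.cong neg (≡.sym x≡-y)))

  ≈-trans : ∀ {x y z} → x ≈ y → y ≈ z → x ≈ z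
  ≈-trans (inj₁ ≡.refl) y≈z = y≈z
  ≈-trans (inj₂ ≡.refl) (inj₁ ≡.refl) = inj₂ ≡.refl
  ≈-trans (inj₂ ≡.refl) (inj₂ ≡.refl) = inj₁ (neg-involutive _)

  ·-congˡ : ∀ x {y z} → y ≈ z → x · y ≈ x · z
  ·-congˡ x (inj₁ ≡.refl) = inj₁ ≡.refl
  ·-congˡ x (inj₂ ≡.refl) = inj₂ (neg-·ʳ x _)

  ·-congʳ : ∀ x {y z} → y ≈ z → y · x ≈ z · x
  ·-congʳ x (inj₁ ≡.refl) = inj₁ ≡.refl
  ·-congʳ x (inj₂ ≡.refl) = inj₂ (neg-·ˡ _ x)

  ·-cancelʳ : ∀ {x} → InSL x → ∀ {y z} → y · x ≈ z · x → y ≈ z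
  ·-cancelʳ {x} dx {y} {z} yx≈zx = ≈-trans (≈-sym (undo y)) (≈-trans (·-congʳ (adj x) yx≈zx) (undo z))
    where
    undo : ∀ y → (y · x) · adj x ≈ y
    undo y = ≈-reflexive (≡.trans (·-assoc y x (adj x)) (≡.trans (≡.cong (y ·_) (adj-inverseʳ dx)) (·-identityʳ y)))

  U : Carrier → Mat
  U s = mat 1# s 0# 1#

  InSL-U : ∀ s → InSL (U s)
  InSL-U s = solve 1 (λ s → con (+ 1) :* con (+ 1) :+ :- (s :* con (+ 0)) := con (+ 1)) ≡.refl s

  U-+ : ∀ s t → U s · U t ≡ U (s + t)
  U-+ s t = mat-cong (a1+b0 1# s)
    (solve 2 (λ s t → con (+ 1) :* t :+ s :* con (+ 1) := s :+ t) ≡.refl s t) (0a+1b 1# 0#) (0a+1b t 1#)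

  -- The conjugates of U c: x and y are the entries of the first column of the conjugating matrix.
  T : Carrier → Carrier → Carrier → Mat
  T c x y = mat (1# - c * x * y) (c * x * x) (- (c * y * y)) (1# + c * x * y)

  conjugate-U : ∀ {m} c → InSL m → (m · U c) · adj m ≡ T c (Mat.a m) (Mat.c m)
  conjugate-U {mat a b c d} e ad-bc≡1 = mat-cong
    (begin
      (a * 1# + b * 0#) * d + (a * e + b * 1#) * - c
        ≡⟨ solve 5 (λ a b c d e → (a :* con (+ 1) :+ b :* con (+ 0)) :* d :+ (a :* e :+ b :* con (+ 1)) :* :- c
             := (a :* d :+ :- (b :* c)) :- e :* a :* c) ≡.refl a b c d e ⟩
      (a * d + - (b * c)) - e * a * c
        ≡⟨ ≡.cong (_- e * a * c) ad-bc≡1 ⟩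
      1# - e * a * c ∎)
    (solve 3 (λ a b e → (a :* con (+ 1) :+ b :* con (+ 0)) :* :- b :+ (a :* e :+ b :* con (+ 1)) :* a
             := e :* a :* a) ≡.refl a b e)
    (solve 3 (λ c d e → (c :* con (+ 1) :+ d :* con (+ 0)) :* d :+ (c :* e :+ d :* con (+ 1)) :* :- c
             := :- (e :* c :* c)) ≡.refl c d e)
    (begin
      (c * 1# + d * 0#) * - b + (c * e + d * 1#) * a
        ≡⟨ solve 5 (λ a b c d e → (c :* con (+ 1) :+ d :* con (+ 0)) :* :- b :+ (c :* e :+ d :* con (+ 1)) :* a
             := (a :* d :+ :- (b :* c)) :+ e :* a :* c) ≡.refl a b c d e ⟩
      (a * d + - (b * c)) + e * a * c
        ≡⟨ ≡.cong (λ z → z + e * a * c) ad-bc≡1 ⟩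
      1# + e * a * c ∎)
    where open ≡.≡-Reasoning

  module _ {u P c} (uP≈PU : u · P ≈ P · U c) (dP : InSL P) where

    power-normalForm : ∀ i → (u ^ᴹ i) · P ≈ P · U ((i ˣ 1#) * c)
    power-normalForm zero = ≈-reflexive (≡.trans (·-identityˡ P) (≡.sym (≡.trans
      (≡.cong (λ s → P · U s) (zeroˡ c)) (·-identityʳ P))))
    power-normalForm (suc i) =
      ≈-trans (≈-reflexive (·-assoc u (u ^ᴹ i) P)) (
      ≈-trans (·-congˡ u (power-normalForm i)) (
      ≈-trans (≈-reflexive (≡.sym (·-assoc u P _))) (
      ≈-trans (·-congʳ _ uP≈PU) (≈-reflexive (≡.trans (·-assoc P _ _) (≡.cong (P ·_)
        (≡.trans (U-+ c _) (≡.cong U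
          (solve 2 (λ c i → c :+ i :* c := (con (+ 1) :+ i) :* c) ≡.refl c (i ˣ 1#))))))))))

    Agree⇒T : ∀ {p g h} → Agree u p g h → ∃[ i ] ∃[ x ] ∃[ y ] g ≈ T ((i ˣ 1#) * c) x y · h
    Agree⇒T {p} {g} {h} (x , dx , i , _ , xg≈uⁱxh) = i , Mat.a m , Mat.c m ,
      ≈-trans (≈-reflexive (≡.sym (≡.trans (≡.sym (·-assoc x⁻¹ x g)) (≡.trans (≡.cong (_· g) (adj-inverseˡ dx)) (·-identityˡ g))))) (
      ≈-trans (·-congˡ x⁻¹ xg≈uⁱxh) (
      ≈-trans (≈-reflexive (≡.trans (≡.cong (x⁻¹ ·_) (≡.sym (·-assoc uⁱ x h))) (≡.sym (·-assoc x⁻¹ (uⁱ · x) h))))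
      (·-congʳ h
        (·-cancelʳ {m} dm (≈-trans (≈-reflexive (begin
          (x⁻¹ · (uⁱ · x)) · (x⁻¹ · P) ≡⟨ ·-assoc x⁻¹ (uⁱ · x) m ⟩
          x⁻¹ · ((uⁱ · x) · (x⁻¹ · P)) ≡⟨ ≡.cong (x⁻¹ ·_) (·-assoc uⁱ x m) ⟩
          x⁻¹ · (uⁱ · (x · (x⁻¹ · P))) ≡⟨ ≡.cong (λ z → x⁻¹ · (uⁱ · z)) (≡.trans (≡.sym (·-assoc x x⁻¹ P))
                                             (≡.trans (≡.cong (_· P) (adj-inverseʳ dx)) (·-identityˡ P))) ⟩
          x⁻¹ · (uⁱ · P)               ∎)) (≈-trans (·-congˡ x⁻¹ (power-normalForm i)) (≈-reflexive (begin
          x⁻¹ · (P · U e)              ≡⟨ ·-assoc x⁻¹ P (U e) ⟨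
          m · U e                      ≡⟨ ·-identityʳ (m · U e) ⟨
          m · U e · I                  ≡⟨ ≡.cong (m · U e ·_) (adj-inverseˡ dm) ⟨
          m · U e · (adj m · m)        ≡⟨ ·-assoc (m · U e) (adj m) m ⟨
          m · U e · adj m · m          ≡⟨ ≡.cong (_· m) (conjugate-U e dm) ⟩
          T e (Mat.a m) (Mat.c m) · m  ∎))))))))
      where
      open ≡.≡-Reasoning
      x⁻¹ = adj x
      uⁱ = u ^ᴹ i
      e = (i ˣ 1#) * c
      m = x⁻¹ · P
      dm = InSL-· {x⁻¹} {P} (InSL-adj {x} dx) dP

    Agree-U : ∀ {p} i → i ℕ.< p → ∀ {s t d} → d ≢ 0# → d * d * (s - t) ≡ (i ˣ 1#) * c → Agree u p (U s) (U t)
    Agree-U i i<p {s} {t} {d} d≢0 dd[s-t]≡ic with w , dw≡1 ← inverse d d≢0 =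
      P · D , InSL-· {P} {D} dP dD , i , i<p ,
      ≈-trans (≈-reflexive (≡.trans (·-assoc P D (U s)) (≡.trans (≡.cong (P ·_) DU≡UDU) (≡.sym (·-assoc P (U e) (D · U t))))))
      (≈-trans (·-congʳ (D · U t) (≈-sym (power-normalForm i)))
      (≈-reflexive (≡.trans (·-assoc _ P (D · U t)) (≡.cong (u ^ᴹ i ·_) (≡.sym (·-assoc P D (U t)))))))
      where
      open ≡.≡-Reasoning
      e = (i ˣ 1#) * c
      D = mat d 0# 0# w
      dD : InSL D
      dD = ≡.trans (solve 2 (λ d w → d :* w :+ :- (con (+ 0) :* con (+ 0)) := d :* w) ≡.refl d w) dw≡1
      DU≡UDU : D · U s ≡ U e · (D · U t)
      DU≡UDU = mat-cong
        (solve 3 (λ d e w → d :* con (+ 1) :+ con (+ 0) :* con (+ 0) :=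
           con (+ 1) :* (d :* con (+ 1) :+ con (+ 0) :* con (+ 0)) :+ e :* (con (+ 0) :* con (+ 1) :+ w :* con (+ 0)))
           ≡.refl d e w)
        (begin
          d * s + 0# * 1#
            ≡⟨ solve 3 (λ d s t → d :* s :+ con (+ 0) :* con (+ 1) := d :* t :+ d :* (s :- t) :* con (+ 1)) ≡.refl d s t ⟩
          d * t + d * (s - t) * 1#
            ≡⟨ ≡.cong (λ z → d * t + d * (s - t) * z) dw≡1 ⟨
          d * t + d * (s - t) * (d * w)
            ≡⟨ solve 4 (λ d s t w → d :* t :+ d :* (s :- t) :* (d :* w) :=
                 con (+ 1) :* (d :* t :+ con (+ 0) :* con (+ 1)) :+
                 d :* d :* (s :- t) :* (con (+ 0) :* t :+ w :* con (+ 1))) ≡.refl d s t w ⟩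
          1# * (d * t + 0# * 1#) + d * d * (s - t) * (0# * t + w * 1#)
            ≡⟨ ≡.cong (λ z → 1# * (d * t + 0# * 1#) + z * (0# * t + w * 1#)) dd[s-t]≡ic ⟩
          1# * (d * t + 0# * 1#) + e * (0# * t + w * 1#) ∎)
        (solve 2 (λ d w → con (+ 0) :* con (+ 1) :+ w :* con (+ 0) :=
           con (+ 0) :* (d :* con (+ 1) :+ con (+ 0) :* con (+ 0)) :+ con (+ 1) :* (con (+ 0) :* con (+ 1) :+ w :* con (+ 0)))
           ≡.refl d w)
        (solve 4 (λ d s t w → con (+ 0) :* s :+ w :* con (+ 1) :=
           con (+ 0) :* (d :* t :+ con (+ 0) :* con (+ 1)) :+ con (+ 1) :* (con (+ 0) :* t :+ w :* con (+ 1)))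
           ≡.refl d s t w)

module ElementsOfOrderP (F : Field) (_≟_ : DecidableEquality (Field.Carrier F)) {p : ℕ} (pr : Prime p)
                        (p≡0 : FieldProperties._ˣ_ F p (Field.1# F) ≡ Field.0# F) where
  open FieldProperties F
  open MatrixProperties F
  open import Algebra.Properties.Semiring.Exp matSemiring using () renaming (_^_ to _^′_)
  open import Algebra.Properties.Semiring.Mult matSemiring using () renaming (_×_ to _ˣᴹ_)
  open ≡.≡-Reasoning

  x^n≡0⇒x≡0 : ∀ n {x} → x ^ n ≡ 0# → x ≡ 0#
  x^n≡0⇒x≡0 n {x} x^n≡0 with x ≟ 0#
  ... | yes x≡0 = x≡0
  ... | no x≢0 = contradiction x^n≡0 (^-≢0 n x≢0)

  pˣx≡0 : ∀ x → p ˣ x ≡ 0#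
  pˣx≡0 x = begin
    p ˣ x           ≡⟨ ≡.cong (p ˣ_) (*-identityˡ x) ⟨
    p ˣ (1# * x)    ≡⟨ ˣ-assoc-* p 1# x ⟨
    (p ˣ 1#) * x    ≡⟨ ≡.cong (_* x) p≡0 ⟩
    0# * x          ≡⟨ zeroˡ x ⟩
    0#              ∎

  ˣᴹ-entries : ∀ n a b c d → n ˣᴹ mat a b c d ≡ mat (n ˣ a) (n ˣ b) (n ˣ c) (n ˣ d)
  ˣᴹ-entries zero a b c d = ≡.refl
  ˣᴹ-entries (suc n) a b c d = ≡.cong (mat a b c d ⊕_) (ˣᴹ-entries n a b c d)

  pˣᴹm≡0 : ∀ m → p ˣᴹ m ≡ 𝟎
  pˣᴹm≡0 (mat a b c d) = ≡.trans (ˣᴹ-entries p a b c d) (mat-cong (pˣx≡0 a) (pˣx≡0 b) (pˣx≡0 c) (pˣx≡0 d))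

  ^ᴹ≡^′ : ∀ m n → m ^ᴹ n ≡ m ^′ n
  ^ᴹ≡^′ m zero = ≡.refl
  ^ᴹ≡^′ m (suc n) = ≡.cong (m ·_) (^ᴹ≡^′ m n)

  I^n≡I : ∀ n → I ^′ n ≡ I
  I^n≡I zero = ≡.refl
  I^n≡I (suc n) = ≡.trans (·-identityˡ _) (I^n≡I n)

  [m⊕I]^p≡m^p⊕I : ∀ m → (m ⊕ I) ^ᴹ p ≡ m ^ᴹ p ⊕ I
  [m⊕I]^p≡m^p⊕I m = begin
    (m ⊕ I) ^ᴹ p        ≡⟨ ^ᴹ≡^′ (m ⊕ I) p ⟩
    (m ⊕ I) ^′ p        ≡⟨ frobenius-+ pr pˣᴹm≡0 m I (≡.trans (·-identityʳ m) (≡.sym (·-identityˡ m))) ⟩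
    m ^′ p ⊕ I ^′ p     ≡⟨ ≡.cong₂ _⊕_ (≡.sym (^ᴹ≡^′ m p)) (I^n≡I p) ⟩
    m ^ᴹ p ⊕ I          ∎
    where open Frobenius matSemiring

  ⊕-cancelʳ : ∀ m m′ k → m ⊕ k ≡ m′ ⊕ k → m ≡ m′
  ⊕-cancelʳ m@(mat a b c d) m′@(mat e f g h) k@(mat _ _ _ _) eq =
    mat-cong (+-cancel (≡.cong Mat.a eq)) (+-cancel (≡.cong Mat.b eq)) (+-cancel (≡.cong Mat.c eq)) (+-cancel (≡.cong Mat.d eq))
    where
    +-cancel : ∀ {x y z} → x + z ≡ y + z → x ≡ y
    +-cancel {x} {y} {z} eq = begin
      x            ≡⟨ solve 2 (λ x z → x := x :+ z :- z) ≡.refl x z ⟩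
      (x + z) - z  ≡⟨ ≡.cong (_- z) eq ⟩
      (y + z) - z  ≡⟨ solve 2 (λ x z → x :+ z :- z := x) ≡.refl y z ⟩
      y            ∎

  nilpotent⇒det≡0 : ∀ m n → m ^ᴹ n ≡ 𝟎 → det m ≡ 0#
  nilpotent⇒det≡0 m n m^n≡0 = x^n≡0⇒x≡0 n (begin
    det m ^ n       ≡⟨ det-^ n ⟨
    det (m ^ᴹ n)    ≡⟨ ≡.cong det m^n≡0 ⟩
    det 𝟎           ≡⟨ solve 0 (con (+ 0) :* con (+ 0) :+ :- (con (+ 0) :* con (+ 0)) := con (+ 0)) ≡.refl ⟩
    0#              ∎)
    where
    det-^ : ∀ n → det (m ^ᴹ n) ≡ det m ^ n
    det-^ zero = det-I
    det-^ (suc n) = ≡.trans (det-· m (m ^ᴹ n)) (≡.cong (det m *_) (det-^ n))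

  trace≡2 : ∀ {u} → InSL u → u ^ᴹ p ≡ I → Mat.a u + Mat.d u ≡ 2#
  trace≡2 {u@(mat a b c d)} ad-bc≡1 u^p≡I = begin
    a + d
      ≡⟨ solve 4 (λ a b c d → a :+ d := ((a :* d :+ :- (b :* c)) :+ con (+ 1)) :-
           ((a :+ :- con (+ 1)) :* (d :+ :- con (+ 1)) :+ :- ((b :+ :- con (+ 0)) :* (c :+ :- con (+ 0))))) ≡.refl a b c d ⟩
    (det u + 1#) - det N
      ≡⟨ ≡.cong₂ (λ x y → (x + 1#) - y) ad-bc≡1 (nilpotent⇒det≡0 N p N^p≡0) ⟩
    2# - 0#
      ≡⟨ solve 0 (con (+ 1) :+ con (+ 1) :- con (+ 0) := con (+ 1) :+ con (+ 1)) ≡.refl ⟩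
    2# ∎
    where
    N = u ⊕ neg I
    N⊕I≡u : N ⊕ I ≡ u
    N⊕I≡u = mat-cong (cancel a 1#) (cancel b 0#) (cancel c 0#) (cancel d 1#)
      where
      cancel : ∀ x y → x + - y + y ≡ x
      cancel = solve 2 (λ x y → x :+ :- y :+ y := x) ≡.refl
    N^p≡0 : N ^ᴹ p ≡ 𝟎
    N^p≡0 = ⊕-cancelʳ (N ^ᴹ p) 𝟎 I (begin
      N ^ᴹ p ⊕ I      ≡⟨ [m⊕I]^p≡m^p⊕I N ⟨
      (N ⊕ I) ^ᴹ p    ≡⟨ ≡.cong (_^ᴹ p) N⊕I≡u ⟩
      u ^ᴹ p          ≡⟨ u^p≡I ⟩
      I               ≡⟨ mat-cong (+-identityˡ _) (+-identityˡ _) (+-identityˡ _) (+-identityˡ _) ⟨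
      𝟎 ⊕ I           ∎)

  trace≡-2 : ∀ {u} → InSL u → u ^ᴹ p ≡ neg I → Mat.a u + Mat.d u ≡ - 2#
  trace≡-2 {u@(mat a b c d)} ad-bc≡1 u^p≡-I = begin
    a + d
      ≡⟨ solve 4 (λ a b c d → a :+ d :=
           ((a :+ con (+ 1)) :* (d :+ con (+ 1)) :+ :- ((b :+ con (+ 0)) :* (c :+ con (+ 0)))) :-
           ((a :* d :+ :- (b :* c)) :+ con (+ 1))) ≡.refl a b c d ⟩
    det N - (det u + 1#)
      ≡⟨ ≡.cong₂ (λ x y → y - (x + 1#)) ad-bc≡1 (nilpotent⇒det≡0 N p N^p≡0) ⟩
    0# - 2#
      ≡⟨ +-identityˡ _ ⟩
    - 2# ∎
    where
    N = u ⊕ I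
    N^p≡0 : N ^ᴹ p ≡ 𝟎
    N^p≡0 = begin
      N ^ᴹ p          ≡⟨ [m⊕I]^p≡m^p⊕I u ⟩
      u ^ᴹ p ⊕ I      ≡⟨ ≡.cong (_⊕ I) u^p≡-I ⟩
      neg I ⊕ I       ≡⟨ mat-cong (-‿inverseˡ _) (-‿inverseˡ _) (-‿inverseˡ _) (-‿inverseˡ _) ⟩
      𝟎               ∎

  unipotent-normalForm : ∀ {u} → InSL u → Mat.a u + Mat.d u ≡ 2# → u ≢ I →
                         ∃[ P ] ∃[ e ] InSL P × e ≢ 0# × u · P ≡ P · U e
  unipotent-normalForm {u@(mat a b c d)} ad-bc≡1 a+d≡2 u≢I with c ≟ 0#
  ... | yes ≡.refl = I , b , det-I , b≢0 , ≡.trans (·-identityʳ u) (≡.trans u≡Ub (≡.sym (·-identityˡ (U b))))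
    where
    a≡1 : a ≡ 1#
    a≡1 = -‿≡0⇒≡ (x^n≡0⇒x≡0 2 (begin
      (a - 1#) * ((a - 1#) * 1#)
        ≡⟨ solve 3 (λ a b d → (a :- con (+ 1)) :* ((a :- con (+ 1)) :* con (+ 1)) :=
             a :* ((a :+ d) :- (con (+ 1) :+ con (+ 1))) :- ((a :* d :+ :- (b :* con (+ 0))) :- con (+ 1))) ≡.refl a b d ⟩
      a * ((a + d) - 2#) - (det u - 1#)
        ≡⟨ ≡.cong₂ (λ x y → a * x - y) (≡⇒-‿≡0 a+d≡2) (≡⇒-‿≡0 ad-bc≡1) ⟩
      a * 0# - 0#
        ≡⟨ solve 1 (λ a → a :* con (+ 0) :- con (+ 0) := con (+ 0)) ≡.refl a ⟩
      0# ∎))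
    d≡1 : d ≡ 1#
    d≡1 = begin
      d             ≡⟨ solve 2 (λ a d → d := (a :+ d) :- a) ≡.refl a d ⟩
      (a + d) - a   ≡⟨ ≡.cong₂ _-_ a+d≡2 a≡1 ⟩
      2# - 1#       ≡⟨ solve 0 (con (+ 1) :+ con (+ 1) :- con (+ 1) := con (+ 1)) ≡.refl ⟩
      1#            ∎
    u≡Ub : u ≡ U b
    u≡Ub = mat-cong a≡1 ≡.refl ≡.refl d≡1
    b≢0 : b ≢ 0#
    b≢0 b≡0 = u≢I (≡.trans u≡Ub (≡.cong U b≡0))
  ... | no c≢0 with w , cw≡1 ← inverse c c≢0 = P , - c , dP , -c≢0 , mat-cong
        (begin
          a * x + b * 1#
            ≡⟨ solve 5 (λ a b c d w → a :* ((a :- con (+ 1)) :* w) :+ b :* con (+ 1) :=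
                 (a :- con (+ 1)) :* w :+ (a :* w :* ((a :+ d) :- (con (+ 1) :+ con (+ 1)))
                  :- w :* ((a :* d :+ :- (b :* c)) :- con (+ 1))) :- b :* (c :* w :- con (+ 1))) ≡.refl a b c d w ⟩
          x + (a * w * ((a + d) - 2#) - w * (det u - 1#)) - b * (c * w - 1#)
            ≡⟨ ≡.cong₂ (λ y z → x + (a * w * y - w * z) - b * (c * w - 1#)) (≡⇒-‿≡0 a+d≡2) (≡⇒-‿≡0 ad-bc≡1) ⟩
          x + (a * w * 0# - w * 0#) - b * (c * w - 1#)
            ≡⟨ ≡.cong (λ y → x + (a * w * 0# - w * 0#) - b * y) (≡⇒-‿≡0 cw≡1) ⟩
          x + (a * w * 0# - w * 0#) - b * 0#
            ≡⟨ solve 4 (λ a b w x → x :+ (a :* w :* con (+ 0) :- w :* con (+ 0)) :- b :* con (+ 0) :=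
                 x :* con (+ 1) :+ :- con (+ 1) :* con (+ 0)) ≡.refl a b w x ⟩
          x * 1# + - 1# * 0# ∎)
        (begin
          a * - 1# + b * 0#
            ≡⟨ solve 4 (λ a b c w → a :* :- con (+ 1) :+ b :* con (+ 0) :=
                 ((a :- con (+ 1)) :* w :* :- c :+ :- con (+ 1) :* con (+ 1)) :+ (a :- con (+ 1)) :* (c :* w :- con (+ 1))) ≡.refl a b c w ⟩
          (x * - c + - 1# * 1#) + (a - 1#) * (c * w - 1#)
            ≡⟨ ≡.cong (λ y → (x * - c + - 1# * 1#) + (a - 1#) * y) (≡⇒-‿≡0 cw≡1) ⟩
          (x * - c + - 1# * 1#) + (a - 1#) * 0#
            ≡⟨ solve 2 (λ y a → y :+ (a :- con (+ 1)) :* con (+ 0) := y) ≡.refl _ a ⟩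
          x * - c + - 1# * 1# ∎)
        (begin
          c * x + d * 1#
            ≡⟨ solve 4 (λ a c d w → c :* ((a :- con (+ 1)) :* w) :+ d :* con (+ 1) :=
                 (a :- con (+ 1)) :* (c :* w :- con (+ 1)) :+ ((a :+ d) :- (con (+ 1) :+ con (+ 1))) :+ con (+ 1)) ≡.refl a c d w ⟩
          (a - 1#) * (c * w - 1#) + ((a + d) - 2#) + 1#
            ≡⟨ ≡.cong₂ (λ y z → (a - 1#) * y + z + 1#) (≡⇒-‿≡0 cw≡1) (≡⇒-‿≡0 a+d≡2) ⟩
          (a - 1#) * 0# + 0# + 1#
            ≡⟨ solve 1 (λ a → (a :- con (+ 1)) :* con (+ 0) :+ con (+ 0) :+ con (+ 1) :=
                 con (+ 1) :* con (+ 1) :+ con (+ 0) :* con (+ 0)) ≡.refl a ⟩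
          1# * 1# + 0# * 0# ∎)
        (solve 2 (λ c d → c :* :- con (+ 1) :+ d :* con (+ 0) := con (+ 1) :* :- c :+ con (+ 0) :* con (+ 1)) ≡.refl c d)
    where
    x = (a - 1#) * w
    P = mat x (- 1#) 1# 0#
    dP : InSL P
    dP = solve 1 (λ x → x :* con (+ 0) :+ :- (:- con (+ 1) :* con (+ 1)) := con (+ 1)) ≡.refl x
    -c≢0 : - c ≢ 0#
    -c≢0 -c≡0 = c≢0 (begin
      c        ≡⟨ solve 1 (λ c → c := :- (:- c)) ≡.refl c ⟩
      - (- c)  ≡⟨ ≡.cong -_ -c≡0 ⟩
      - 0#     ≡⟨ solve 0 (:- con (+ 0) := con (+ 0)) ≡.refl ⟩
      0#       ∎)

  abstract
    order-p-normalForm : ∀ {u} → OrderPrime u p → ∃[ P ] ∃[ e ] InSL P × e ≢ 0# × u · P ≈ P · U e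
    order-p-normalForm {u} (du , u≉I , inj₁ u^p≡I)
      with P , e , dP , e≢0 , eq ← unipotent-normalForm {u} du (trace≡2 {u} du u^p≡I) (λ u≡I → u≉I (inj₁ u≡I))
      = P , e , dP , e≢0 , inj₁ eq
    order-p-normalForm {u@(mat a b c d)} (du , u≉I , inj₂ u^p≡-I)
      with P , e , dP , e≢0 , eq ← unipotent-normalForm {neg u} (≡.trans (det-neg u) du)
             (begin
               - a + - d     ≡⟨ solve 2 (λ a d → :- a :+ :- d := :- (a :+ d)) ≡.refl a d ⟩
               - (a + d)     ≡⟨ ≡.cong -_ (trace≡-2 {u} du u^p≡-I) ⟩
               - (- 2#)      ≡⟨ solve 0 (:- (:- (con (+ 1) :+ con (+ 1))) := con (+ 1) :+ con (+ 1)) ≡.refl ⟩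
               2#            ∎)
             (λ -u≡I → u≉I (inj₂ (≡.trans (≡.sym (neg-involutive u)) (≡.cong neg -u≡I))))
      = P , e , dP , e≢0 , inj₂ (≡.trans (≡.sym (neg-involutive (u · P))) (≡.cong neg (≡.trans (≡.sym (neg-·ˡ u P)) eq)))

module Cliques (F : Field) (_≟_ : DecidableEquality (Field.Carrier F))
               (2≢0 : MatrixProperties.2# F ≢ Field.0# F)
               (3≢0 : Field._+_ F (MatrixProperties.2# F) (Field.1# F) ≢ Field.0# F) where
  open FieldProperties F
  open MatrixProperties F
  open ≡.≡-Reasoning

  record Transvection : Set where
    constructor transvection
    field c x y : Carrier

  τ : Transvection → Mat
  τ (transvection c x y) = T c x y

  4# : Carrier
  4# = 2# * 2#

  4≢0 : 4# ≢ 0#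
  4≢0 = *-≢0 2≢0 2≢0

  -x≡0⇒x≡0 : ∀ {x} → - x ≡ 0# → x ≡ 0#
  -x≡0⇒x≡0 {x} -x≡0 = begin
    x        ≡⟨ solve 1 (λ x → x := :- (:- x)) ≡.refl x ⟩
    - (- x)  ≡⟨ ≡.cong -_ -x≡0 ⟩
    - 0#     ≡⟨ solve 0 (:- con (+ 0) := con (+ 0)) ≡.refl ⟩
    0#       ∎

  x²≡0⇒x≡0 : ∀ {x} → x * x ≡ 0# → x ≡ 0#
  x²≡0⇒x≡0 {x} x²≡0 with x ≟ 0#
  ... | yes x≡0 = x≡0
  ... | no x≢0 = x*y≡0⇒y≡0 x≢0 x²≡0

  x²≡y²⇒ : ∀ {x y} → x * x ≡ y * y → y ≡ x ⊎ y ≡ - x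
  x²≡y²⇒ {x} {y} x²≡y² with y ≟ x
  ... | yes y≡x = inj₁ y≡x
  ... | no y≢x = inj₂ (-‿≡0⇒≡ (x*y≡0⇒y≡0 (λ y-x≡0 → y≢x (-‿≡0⇒≡ y-x≡0)) (begin
      (y - x) * (y - - x)  ≡⟨ solve 2 (λ x y → (y :- x) :* (y :- :- x) := y :* y :- x :* x) ≡.refl x y ⟩
      y * y - x * x        ≡⟨ ≡⇒-‿≡0 (≡.sym x²≡y²) ⟩
      0#                   ∎)))

  ω : Transvection → Transvection → Carrier
  ω (transvection _ x y) (transvection _ x′ y′) = x * y′ - y * x′

  -- Minus the trace of (τ P − I)(τ Q − I).
  pairing : Transvection → Transvection → Carrier
  pairing P Q = Transvection.c P * Transvection.c Q * (ω P Q * ω P Q)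

  pairing-comm : ∀ P Q → pairing P Q ≡ pairing Q P
  pairing-comm (transvection c x y) (transvection c′ x′ y′) = solve 6 (λ c x y c′ x′ y′ →
    c :* c′ :* ((x :* y′ :- y :* x′) :* (x :* y′ :- y :* x′)) :=
    c′ :* c :* ((x′ :* y :- y′ :* x) :* (x′ :* y :- y′ :* x))) ≡.refl c x y c′ x′ y′

  pairing-self : ∀ P → pairing P P ≡ 0#
  pairing-self (transvection c x y) = solve 3 (λ c x y →
    c :* c :* ((x :* y :- y :* x) :* (x :* y :- y :* x)) := con (+ 0)) ≡.refl c x y

  trace : Mat → Carrier
  trace (mat a b c d) = a + d

  trace-T : ∀ c x y → trace (T c x y) ≡ 2#
  trace-T = solve 3 (λ c x y → (con (+ 1) :- c :* x :* y) :+ (con (+ 1) :+ c :* x :* y) := con (+ 1) :+ con (+ 1)) ≡.refl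

  trace-neg : ∀ m → trace (neg m) ≡ - trace m
  trace-neg (mat a b c d) = solve 2 (λ a d → :- a :+ :- d := :- (a :+ d)) ≡.refl a d

  T-0 : ∀ x y → T 0# x y ≡ I
  T-0 x y = mat-cong
    (solve 2 (λ x y → con (+ 1) :- con (+ 0) :* x :* y := con (+ 1)) ≡.refl x y)
    (solve 1 (λ x → con (+ 0) :* x :* x := con (+ 0)) ≡.refl x)
    (solve 1 (λ y → :- (con (+ 0) :* y :* y) := con (+ 0)) ≡.refl y)
    (solve 2 (λ x y → con (+ 1) :+ con (+ 0) :* x :* y := con (+ 1)) ≡.refl x y)

  T-scale : ∀ c r x y → T c (r * x) (r * y) ≡ T (c * (r * r)) x y
  T-scale c r x y = mat-cong (≡.cong (λ z → 1# - z) (entry x y)) (entry x x) (≡.cong -_ (entry y y)) (≡.cong (λ z → 1# + z) (entry x y))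
    where
    entry : ∀ x y → c * (r * x) * (r * y) ≡ c * (r * r) * x * y
    entry x y = solve 4 (λ c r x y → c :* (r :* x) :* (r :* y) := c :* (r :* r) :* x :* y) ≡.refl c r x y

  T-+ : ∀ c d x y → T c x y · T d x y ≡ T (c + d) x y
  T-+ c d x y = mat-cong
    (solve 4 (λ c d x y → (con (+ 1) :- c :* x :* y) :* (con (+ 1) :- d :* x :* y) :+ c :* x :* x :* :- (d :* y :* y) :=
      con (+ 1) :- (c :+ d) :* x :* y) ≡.refl c d x y)
    (solve 4 (λ c d x y → (con (+ 1) :- c :* x :* y) :* (d :* x :* x) :+ c :* x :* x :* (con (+ 1) :+ d :* x :* y) :=
      (c :+ d) :* x :* x) ≡.refl c d x y)
    (solve 4 (λ c d x y → :- (c :* y :* y) :* (con (+ 1) :- d :* x :* y) :+ (con (+ 1) :+ c :* x :* y) :* :- (d :* y :* y) :=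
      :- ((c :+ d) :* y :* y)) ≡.refl c d x y)
    (solve 4 (λ c d x y → :- (c :* y :* y) :* (d :* x :* x) :+ (con (+ 1) :+ c :* x :* y) :* (con (+ 1) :+ d :* x :* y) :=
      con (+ 1) :+ (c :+ d) :* x :* y) ≡.refl c d x y)

  trace-T·T⁻¹ : ∀ P Q → trace (τ P · τ (transvection (- Transvection.c Q) (Transvection.x Q) (Transvection.y Q))) ≡ 2# + pairing P Q
  trace-T·T⁻¹ (transvection c x y) (transvection d z w) = solve 6 (λ c x y d z w →
    ((con (+ 1) :- c :* x :* y) :* (con (+ 1) :- :- d :* z :* w) :+ c :* x :* x :* :- (:- d :* w :* w)) :+
    (:- (c :* y :* y) :* (:- d :* z :* z) :+ (con (+ 1) :+ c :* x :* y) :* (con (+ 1) :+ :- d :* z :* w)) :=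
    con (+ 1) :+ con (+ 1) :+ c :* d :* ((x :* w :- y :* z) :* (x :* w :- y :* z))) ≡.refl c x y d z w

  T⁻¹-cancel : ∀ {m n} d z w → m ≈ n · T d z w → m · T (- d) z w ≈ n
  T⁻¹-cancel {m} {n} d z w m≈nT = ≈-trans (·-congʳ (T (- d) z w) m≈nT) (≈-reflexive (begin
    n · T d z w · T (- d) z w    ≡⟨ ·-assoc n _ _ ⟩
    n · (T d z w · T (- d) z w)  ≡⟨ ≡.cong (n ·_) (T-+ d (- d) z w) ⟩
    n · T (d + - d) z w          ≡⟨ ≡.cong (λ e → n · T e z w) (-‿inverseʳ d) ⟩
    n · T 0# z w                 ≡⟨ ≡.cong (n ·_) (T-0 z w) ⟩
    n · I                        ≡⟨ ·-identityʳ n ⟩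
    n                            ∎))

  Compatible : Transvection → Transvection → Set
  Compatible P Q = ∃[ R ] τ P ≈ τ R · τ Q

  trace-values : ∀ {m m′ s} → trace m ≡ 2# + s → trace m′ ≡ 2# → m ≈ m′ → s ≡ 0# ⊎ s ≡ - 4#
  trace-values {s = s} tr tr′ (inj₁ ≡.refl) = inj₁ (begin
    s               ≡⟨ solve 2 (λ s t → s := (t :+ s) :- t) ≡.refl s 2# ⟩
    (2# + s) - 2#   ≡⟨ ≡⇒-‿≡0 (≡.trans (≡.sym tr) tr′) ⟩
    0#              ∎)
  trace-values {m′ = m′} {s} tr tr′ (inj₂ ≡.refl) = inj₂ (begin
    s               ≡⟨ solve 2 (λ s t → s := (t :+ s) :- t) ≡.refl s 2# ⟩
    (2# + s) - 2#   ≡⟨ ≡.cong (_- 2#) (≡.trans (≡.sym tr) (≡.trans (trace-neg m′) (≡.cong -_ tr′))) ⟩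
    - 2# - 2#       ≡⟨ solve 0 (:- (con (+ 1) :+ con (+ 1)) :- (con (+ 1) :+ con (+ 1)) :=
                         :- ((con (+ 1) :+ con (+ 1)) :* (con (+ 1) :+ con (+ 1)))) ≡.refl ⟩
    - 4#            ∎)

  pairing-values : ∀ {P Q} → Compatible P Q → pairing P Q ≡ 0# ⊎ pairing P Q ≡ - 4#
  pairing-values {P} {Q} (R , P≈RQ) = trace-values {s = pairing P Q} (trace-T·T⁻¹ P Q)
    (trace-T (Transvection.c R) (Transvection.x R) (Transvection.y R))
    (T⁻¹-cancel (Transvection.c Q) (Transvection.x Q) (Transvection.y Q) P≈RQ)

  Proper : Transvection → Set
  Proper P = ¬ τ P ≈ I

  proper⇒c≢0 : ∀ {P} → Proper P → Transvection.c P ≢ 0#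
  proper⇒c≢0 {transvection _ x y} proper ≡.refl = proper (inj₁ (T-0 x y))

  proper⇒v≢0 : ∀ {P} → Proper P → Transvection.x P ≢ 0# ⊎ Transvection.y P ≢ 0#
  proper⇒v≢0 {transvection c x y} proper with x ≟ 0# | y ≟ 0#
  ... | no x≢0 | _ = inj₁ x≢0
  ... | _ | no y≢0 = inj₂ y≢0
  ... | yes ≡.refl | yes ≡.refl = contradiction (inj₁ (mat-cong
    (solve 1 (λ c → con (+ 1) :- c :* con (+ 0) :* con (+ 0) := con (+ 1)) ≡.refl c)
    (solve 1 (λ c → c :* con (+ 0) :* con (+ 0) := con (+ 0)) ≡.refl c)
    (solve 1 (λ c → :- (c :* con (+ 0) :* con (+ 0)) := con (+ 0)) ≡.refl c)
    (solve 1 (λ c → con (+ 1) :+ c :* con (+ 0) :* con (+ 0) := con (+ 1)) ≡.refl c))) proper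

  pairing≡0⇒collinear : ∀ {P Q} → Proper P → Proper Q → pairing P Q ≡ 0# →
    ∃[ r ] Transvection.x Q ≡ r * Transvection.x P × Transvection.y Q ≡ r * Transvection.y P
  pairing≡0⇒collinear {P@(transvection c x y)} {Q@(transvection c′ x′ y′)} properP properQ pairing≡0 = help (proper⇒v≢0 properP)
    where
    ω≡0 : x * y′ - y * x′ ≡ 0#
    ω≡0 = x²≡0⇒x≡0 (x*y≡0⇒y≡0 (*-≢0 (proper⇒c≢0 properP) (proper⇒c≢0 properQ)) pairing≡0)
    xy′≡yx′ : x * y′ ≡ y * x′
    xy′≡yx′ = -‿≡0⇒≡ ω≡0
    scale : ∀ {x w} x′ → x * w ≡ 1# → x′ ≡ x′ * w * x
    scale {x} {w} x′ xw≡1 = begin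
      x′            ≡⟨ *-identityʳ x′ ⟨
      x′ * 1#       ≡⟨ ≡.cong (x′ *_) xw≡1 ⟨
      x′ * (x * w)  ≡⟨ solve 3 (λ x w x′ → x′ :* (x :* w) := x′ :* w :* x) ≡.refl x w x′ ⟩
      x′ * w * x    ∎
    help : x ≢ 0# ⊎ y ≢ 0# → ∃[ r ] x′ ≡ r * x × y′ ≡ r * y
    help (inj₁ x≢0) with w , xw≡1 ← inverse x x≢0 = x′ * w , scale x′ xw≡1 , (begin
      y′            ≡⟨ scale y′ xw≡1 ⟩
      y′ * w * x    ≡⟨ solve 3 (λ x w y′ → y′ :* w :* x := w :* (x :* y′)) ≡.refl x w y′ ⟩
      w * (x * y′)  ≡⟨ ≡.cong (w *_) xy′≡yx′ ⟩
      w * (y * x′)  ≡⟨ solve 3 (λ w y x′ → w :* (y :* x′) := x′ :* w :* y) ≡.refl w y x′ ⟩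
      x′ * w * y    ∎)
    help (inj₂ y≢0) with w , yw≡1 ← inverse y y≢0 = y′ * w , (begin
      x′            ≡⟨ scale x′ yw≡1 ⟩
      x′ * w * y    ≡⟨ solve 3 (λ y w x′ → x′ :* w :* y := w :* (y :* x′)) ≡.refl y w x′ ⟩
      w * (y * x′)  ≡⟨ ≡.cong (w *_) xy′≡yx′ ⟨
      w * (x * y′)  ≡⟨ solve 3 (λ w y x′ → w :* (y :* x′) := x′ :* w :* y) ≡.refl w x y′ ⟩
      y′ * w * x    ∎) , scale y′ yw≡1

  pairing-scale : ∀ P Q K r → Transvection.x K ≡ r * Transvection.x P → Transvection.y K ≡ r * Transvection.y P →
                  Transvection.c P * pairing K Q ≡ Transvection.c K * (r * r) * pairing P Q
  pairing-scale (transvection c x y) (transvection c′ x′ y′) (transvection d _ _) r ≡.refl ≡.refl =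
    ≡.trans (≡.cong (λ z → c * (d * c′ * (z * z)))
              (solve 5 (λ r x y x′ y′ → r :* x :* y′ :- r :* y :* x′ := r :* (x :* y′ :- y :* x′)) ≡.refl r x y x′ y′))
            (lemma (x * y′ - y * x′))
    where
    lemma : ∀ w → c * (d * c′ * ((r * w) * (r * w))) ≡ d * (r * r) * (c * c′ * (w * w))
    lemma w = solve 5 (λ c d c′ r w → c :* (d :* c′ :* ((r :* w) :* (r :* w))) := d :* (r :* r) :* (c :* c′ :* (w :* w)))
                ≡.refl c d c′ r w

  τ-scale : ∀ P K r → Transvection.x K ≡ r * Transvection.x P → Transvection.y K ≡ r * Transvection.y P →
            τ K ≡ T (Transvection.c K * (r * r)) (Transvection.x P) (Transvection.y P)
  τ-scale (transvection _ x y) (transvection d _ _) r ≡.refl ≡.refl = T-scale d r x y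

  -- If v_K is proportional to v_P then τ K = T μ v_P, and pairing K Q ∈ {0, pairing P Q} forces μ ∈ {0, c_P}.
  pairing≢0-inherited : ∀ {P Q K} → Proper P → Proper K → ¬ τ P ≈ τ K → Compatible P Q → Compatible K Q →
                        pairing P Q ≢ 0# → pairing P K ≢ 0#
  pairing≢0-inherited {P} {Q} {K} properP properK P≉K P~Q K~Q PQ≢0 PK≡0 =
    [ μ≡0 , μ≡c ]′ (pairing-values {K} {Q} K~Q)
    where
    collinear = pairing≡0⇒collinear {P} {K} properP properK PK≡0
    r = proj₁ collinear
    c = Transvection.c P
    μ = Transvection.c K * (r * r)

    K≡T : τ K ≡ T μ (Transvection.x P) (Transvection.y P)
    K≡T = τ-scale P K r (proj₁ (proj₂ collinear)) (proj₂ (proj₂ collinear))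

    PQ*μ≡c*KQ : pairing P Q * μ ≡ c * pairing K Q
    PQ*μ≡c*KQ = ≡.trans (*-comm (pairing P Q) μ)
      (≡.sym (pairing-scale P Q K r (proj₁ (proj₂ collinear)) (proj₂ (proj₂ collinear))))

    PQ≡-4 : pairing P Q ≡ - 4#
    PQ≡-4 = [ (λ PQ≡0 → contradiction PQ≡0 PQ≢0) , (λ eq → eq) ]′ (pairing-values {P} {Q} P~Q)

    μ≡0 : pairing K Q ≡ 0# → ⊥
    μ≡0 KQ≡0 = properK (inj₁ (≡.trans K≡T (≡.trans
      (≡.cong (λ z → T z (Transvection.x P) (Transvection.y P))
        (x*y≡0⇒y≡0 PQ≢0 (≡.trans PQ*μ≡c*KQ (≡.trans (≡.cong (c *_) KQ≡0) (zeroʳ c)))))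
      (T-0 (Transvection.x P) (Transvection.y P)))))

    μ≡c : pairing K Q ≡ - 4# → ⊥
    μ≡c KQ≡-4 = P≉K (inj₁ (≡.sym (≡.trans K≡T
      (≡.cong (λ z → T z (Transvection.x P) (Transvection.y P))
        (*-cancelˡ PQ≢0 (≡.trans PQ*μ≡c*KQ (≡.trans (≡.cong (c *_) (≡.trans KQ≡-4 (≡.sym PQ≡-4))) (*-comm c (pairing P Q)))))))))

  -- The six values of ω satisfy the Plücker relation ω₁₂ω₃₄ − ω₁₃ω₂₄ + ω₁₄ω₂₃ = 0,
  -- whereas its three terms have the same square 16/(c₁c₂c₃c₄).
  four-pairings-absurd : ∀ P₁ P₂ P₃ P₄ → pairing P₁ P₂ ≡ - 4# → pairing P₃ P₄ ≡ - 4# → pairing P₁ P₃ ≡ - 4# →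
                         pairing P₂ P₄ ≡ - 4# → pairing P₁ P₄ ≡ - 4# → pairing P₂ P₃ ≡ - 4# → ⊥
  four-pairings-absurd P₁@(transvection c₁ x₁ y₁) P₂@(transvection c₂ x₂ y₂) P₃@(transvection c₃ x₃ y₃) P₄@(transvection c₄ x₄ y₄)
                       s₁₂ s₃₄ s₁₃ s₂₄ s₁₄ s₂₃ = cases (x²≡y²⇒ {A} {B} A²≡B²) (x²≡y²⇒ {A} {D} A²≡D²)
    where
    K = c₁ * c₂ * (c₃ * c₄)
    A = ω P₁ P₂ * ω P₃ P₄
    B = ω P₁ P₃ * ω P₂ P₄
    D = ω P₁ P₄ * ω P₂ P₃
    plücker : A - B + D ≡ 0#
    plücker = solve 8 (λ x₁ y₁ x₂ y₂ x₃ y₃ x₄ y₄ →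
      (x₁ :* y₂ :- y₁ :* x₂) :* (x₃ :* y₄ :- y₃ :* x₄) :- (x₁ :* y₃ :- y₁ :* x₃) :* (x₂ :* y₄ :- y₂ :* x₄)
      :+ (x₁ :* y₄ :- y₁ :* x₄) :* (x₂ :* y₃ :- y₂ :* x₃) := con (+ 0)) ≡.refl x₁ y₁ x₂ y₂ x₃ y₃ x₄ y₄
    16# = - 4# * - 4#
    -4≢0 : - 4# ≢ 0#
    -4≢0 -4≡0 = 4≢0 (-x≡0⇒x≡0 -4≡0)
    product : ∀ {s s′ z w} d e f g → d * e * (z * z) ≡ s → f * g * (w * w) ≡ s′ → d * e * (f * g) * ((z * w) * (z * w)) ≡ s * s′
    product {z = z} {w} d e f g ≡.refl ≡.refl =
      solve 6 (λ d e f g z w → d :* e :* (f :* g) :* ((z :* w) :* (z :* w)) := d :* e :* (z :* z) :* (f :* g :* (w :* w)))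
        ≡.refl d e f g z w
    KA² : K * (A * A) ≡ 16#
    KA² = product c₁ c₂ c₃ c₄ s₁₂ s₃₄
    KB² : K * (B * B) ≡ 16#
    KB² = ≡.trans (≡.cong (_* (B * B)) (solve 4 (λ a b c d → a :* b :* (c :* d) := a :* c :* (b :* d)) ≡.refl c₁ c₂ c₃ c₄))
            (product c₁ c₃ c₂ c₄ s₁₃ s₂₄)
    KD² : K * (D * D) ≡ 16#
    KD² = ≡.trans (≡.cong (_* (D * D)) (solve 4 (λ a b c d → a :* b :* (c :* d) := a :* d :* (b :* c)) ≡.refl c₁ c₂ c₃ c₄))
            (product c₁ c₄ c₂ c₃ s₁₄ s₂₃)
    16≢0 : 16# ≢ 0#
    16≢0 = *-≢0 -4≢0 -4≢0
    K≢0 : K ≢ 0#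
    K≢0 K≡0 = 16≢0 (≡.trans (≡.sym KA²) (≡.trans (≡.cong (_* (A * A)) K≡0) (zeroˡ _)))
    A≢0 : A ≢ 0#
    A≢0 A≡0 = 16≢0 (≡.trans (≡.sym KA²) (≡.trans (≡.cong (λ z → K * (z * A)) A≡0)
      (solve 2 (λ K A → K :* (con (+ 0) :* A) := con (+ 0)) ≡.refl K A)))
    A²≡B² : A * A ≡ B * B
    A²≡B² = *-cancelˡ K≢0 (≡.trans KA² (≡.sym KB²))
    A²≡D² : A * A ≡ D * D
    A²≡D² = *-cancelˡ K≢0 (≡.trans KA² (≡.sym KD²))
    cases : B ≡ A ⊎ B ≡ - A → D ≡ A ⊎ D ≡ - A → ⊥
    cases (inj₁ B≡A) (inj₁ D≡A) = A≢0 (begin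
      A          ≡⟨ solve 1 (λ a → a := a :- a :+ a) ≡.refl A ⟩
      A - A + A  ≡⟨ ≡.cong₂ (λ b d → A - b + d) B≡A D≡A ⟨
      A - B + D  ≡⟨ plücker ⟩
      0#         ∎)
    cases (inj₁ B≡A) (inj₂ D≡-A) = A≢0 (-x≡0⇒x≡0 (begin
      - A          ≡⟨ solve 1 (λ a → :- a := a :- a :+ :- a) ≡.refl A ⟩
      A - A + - A  ≡⟨ ≡.cong₂ (λ b d → A - b + d) B≡A D≡-A ⟨
      A - B + D    ≡⟨ plücker ⟩
      0#           ∎))
    cases (inj₂ B≡-A) (inj₁ D≡A) = A≢0 (x*y≡0⇒y≡0 3≢0 (begin
      (2# + 1#) * A  ≡⟨ solve 1 (λ a → (con (+ 1) :+ con (+ 1) :+ con (+ 1)) :* a := a :- :- a :+ a) ≡.refl A ⟩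
      A - - A + A    ≡⟨ ≡.cong₂ (λ b d → A - b + d) B≡-A D≡A ⟨
      A - B + D      ≡⟨ plücker ⟩
      0#             ∎))
    cases (inj₂ B≡-A) (inj₂ D≡-A) = A≢0 (begin
      A              ≡⟨ solve 1 (λ a → a := a :- :- a :+ :- a) ≡.refl A ⟩
      A - - A + - A  ≡⟨ ≡.cong₂ (λ b d → A - b + d) B≡-A D≡-A ⟨
      A - B + D      ≡⟨ plücker ⟩
      0#             ∎)

  module _ {n} (t : Fin n → Transvection) (proper : ∀ i → Proper (t i))
           (distinct : ∀ {i j} → i ≢ j → ¬ τ (t i) ≈ τ (t j))
           (compatible : ∀ i j → Compatible (t i) (t j)) where

    private
      s : Fin n → Fin n → Carrier
      s i j = pairing (t i) (t j)

      inherit : ∀ {i j} k → i ≢ k → s i j ≢ 0# → s i k ≢ 0#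
      inherit {i} {j} k i≢k =
        pairing≢0-inherited {t i} {t j} {t k} (proper i) (proper k) (distinct i≢k) (compatible i j) (compatible k j)

      flip : ∀ {i j} → s i j ≢ 0# → s j i ≢ 0#
      flip {i} {j} sij≢0 sji≡0 = sij≢0 (≡.trans (pairing-comm (t i) (t j)) sji≡0)

      -4-value : ∀ {i j} → s i j ≢ 0# → s i j ≡ - 4#
      -4-value {i} {j} sij≢0 = [ (λ sij≡0 → contradiction sij≡0 sij≢0) , (λ eq → eq) ]′
        (pairing-values {t i} {t j} (compatible i j))

    pairing≡0-among-four : ∀ i j k l → i ≢ k → i ≢ l → j ≢ k → j ≢ l → k ≢ l → s i j ≡ 0#
    pairing≡0-among-four i j k l i≢k i≢l j≢k j≢l k≢l = decidable-stable (s i j ≟ 0#) λ ij →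
      let ik = inherit k i≢k ij
          il = inherit l i≢l ij
          jk = inherit k j≢k (flip ij)
          jl = inherit l j≢l (flip ij)
          kl = inherit l k≢l (flip ik)
      in four-pairings-absurd (t i) (t j) (t k) (t l)
           (-4-value ij) (-4-value kl) (-4-value ik) (-4-value jl) (-4-value il) (-4-value jk)

  module _ {n} (t : Fin (4 ℕ.+ n) → Transvection) (proper : ∀ i → Proper (t i))
           (distinct : ∀ {i j} → i ≢ j → ¬ τ (t i) ≈ τ (t j))
           (compatible : ∀ i j → Compatible (t i) (t j)) where

    pairing₀≡0 : ∀ j → pairing (t 0F) (t j) ≡ 0#
    pairing₀≡0 0F = pairing-self (t 0F)
    pairing₀≡0 1F = pairing≡0-among-four t proper distinct compatible 0F 1F 2F 3F (λ ()) (λ ()) (λ ()) (λ ()) (λ ())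
    pairing₀≡0 j@2F = pairing≡0-among-four t proper distinct compatible 0F j 1F 3F (λ ()) (λ ()) (λ ()) (λ ()) (λ ())
    pairing₀≡0 j@(suc (suc (suc _))) = pairing≡0-among-four t proper distinct compatible 0F j 1F 2F (λ ()) (λ ()) (λ ()) (λ ()) (λ ())

    collinear : ∀ j → ∃[ μ ] τ (t j) ≡ T μ (Transvection.x (t 0F)) (Transvection.y (t 0F))
    collinear j =
      let r , x≡ , y≡ = pairing≡0⇒collinear {t 0F} {t j} (proper 0F) (proper j) (pairing₀≡0 j)
      in Transvection.c (t j) * (r * r) , τ-scale (t 0F) (t j) r x≡ y≡

  T≈T⇒ : ∀ {c x y d z w} → T c x y ≈ T d z w → c * x * x ≡ d * z * z × c * y * y ≡ d * w * w
  T≈T⇒ {c} {x} {y} {d} {z} {w} (inj₁ eq) = ≡.cong Mat.b eq , (begin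
    c * y * y          ≡⟨ -‿involutive _ ⟩
    - (- (c * y * y))  ≡⟨ ≡.cong (λ m → - Mat.c m) eq ⟩
    - (- (d * w * w))  ≡⟨ -‿involutive _ ⟨
    d * w * w          ∎)
    where
    -‿involutive : ∀ x → x ≡ - (- x)
    -‿involutive = solve 1 (λ x → x := :- (:- x)) ≡.refl
  T≈T⇒ {c} {x} {y} {d} {z} {w} (inj₂ eq) = contradiction (begin
    4#         ≡⟨ solve 0 ((con (+ 1) :+ con (+ 1)) :* (con (+ 1) :+ con (+ 1)) :=
                    (con (+ 1) :+ con (+ 1)) :- :- (con (+ 1) :+ con (+ 1))) ≡.refl ⟩
    2# - - 2#  ≡⟨ ≡⇒-‿≡0 (≡.trans (≡.sym (trace-T c x y)) (≡.trans (≡.cong trace eq)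
                    (≡.trans (trace-neg (T d z w)) (≡.cong -_ (trace-T d z w))))) ⟩
    0#         ∎) 4≢0

  module LargeClique {n} (g : Fin (5 ℕ.+ n) → Mat) (g∈SL : ∀ i → InSL (g i))
                     (g-distinct : ∀ {i j} → i ≢ j → ¬ g i ≈ g j)
                     (S : Carrier → Set) (g-clique : ∀ i j → ∃[ P ] S (Transvection.c P) × g i ≈ τ P · g j) where

    private
      t : Fin (4 ℕ.+ n) → Transvection
      t i = proj₁ (g-clique (suc i) 0F)

      g≈t : ∀ i → g (suc i) ≈ τ (t i) · g 0F
      g≈t i = proj₂ (proj₂ (g-clique (suc i) 0F))

      t-proper : ∀ i → Proper (t i)
      t-proper i t≈I = g-distinct {suc i} {0F} (λ ())
        (≈-trans (g≈t i) (≈-trans (·-congʳ (g 0F) t≈I) (≈-reflexive (·-identityˡ (g 0F)))))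

      t-distinct : ∀ {i j} → i ≢ j → ¬ τ (t i) ≈ τ (t j)
      t-distinct {i} {j} i≢j ti≈tj = g-distinct {suc i} {suc j} (λ { ≡.refl → i≢j ≡.refl })
        (≈-trans (g≈t i) (≈-trans (·-congʳ (g 0F) ti≈tj) (≈-sym (g≈t j))))

      t-compatible : ∀ i j → Compatible (t i) (t j)
      t-compatible i j with R , _ , gi≈Rgj ← g-clique (suc i) (suc j) = R , ·-cancelʳ {g 0F} (g∈SL 0F)
        (≈-trans (≈-sym (g≈t i)) (≈-trans gi≈Rgj (≈-trans (·-congˡ (τ R) (g≈t j))
          (≈-reflexive (≡.sym (·-assoc (τ R) (τ (t j)) (g 0F)))))))

    x y : Carrier
    x = Transvection.x (t 0F)
    y = Transvection.y (t 0F)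

    v≢0 : x ≢ 0# ⊎ y ≢ 0#
    v≢0 = proper⇒v≢0 {t 0F} (t-proper 0F)

    μ : Fin (5 ℕ.+ n) → Carrier
    μ zero = 0#
    μ (suc i) = proj₁ (collinear t t-proper t-distinct t-compatible i)

    private
      g≈T : ∀ i → g i ≈ T (μ i) x y · g 0F
      g≈T zero = ≈-sym (≈-reflexive (≡.trans (≡.cong (_· g 0F) (T-0 x y)) (·-identityˡ (g 0F))))
      g≈T (suc i) = ≈-trans (g≈t i)
        (≈-reflexive (≡.cong (_· g 0F) (proj₂ (collinear t t-proper t-distinct t-compatible i))))

    μ-distinct : ∀ {i j} → i ≢ j → μ i ≢ μ j
    μ-distinct {i} {j} i≢j μi≡μj = g-distinct i≢j
      (≈-trans (g≈T i) (≈-trans (≈-reflexive (≡.cong (λ z → T z x y · g 0F) μi≡μj)) (≈-sym (g≈T j))))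

    μ-difference : ∀ i j → ∃[ c ] ∃[ z ] ∃[ w ]
                   S c × (μ i - μ j) * x * x ≡ c * z * z × (μ i - μ j) * y * y ≡ c * w * w
    μ-difference i j with transvection c z w , c∈S , gi≈Rgj ← g-clique i j = c , z , w , c∈S , T≈T⇒
      (≈-trans (≈-reflexive (≡.sym (T-+ (μ i) (- μ j) x y))) (T⁻¹-cancel (μ j) x y
        (·-cancelʳ {g 0F} (g∈SL 0F) (≈-trans (≈-sym (g≈T i)) (≈-trans gi≈Rgj (≈-trans (·-congˡ (T c z w) (g≈T j))
          (≈-reflexive (≡.sym (·-assoc (T c z w) (T (μ j) x y) (g 0F))))))))))

even⊎odd : ∀ n → (∃[ j ] n ≡ 2 ℕ.* j) ⊎ (∃[ j ] n ≡ suc (2 ℕ.* j))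
even⊎odd zero = inj₁ (0 , ≡.refl)
even⊎odd (suc n) with even⊎odd n
... | inj₁ (j , ≡.refl) = inj₂ (j , ≡.refl)
... | inj₂ (j , ≡.refl) = inj₁ (suc j , ≡.sym (ℕ.*-suc 2 j))

prime≥3⇒odd : ∀ {p} → Prime p → 3 ℕ.≤ p → ∃[ a ] p ≡ suc (2 ℕ.* a)
prime≥3⇒odd {p} pr 3≤p with even⊎odd p
... | inj₂ odd = odd
... | inj₁ (j , p≡2j) with prime⇒irreducible pr (divides j (≡.trans p≡2j (ℕ.*-comm 2 j)))
...   | inj₂ ≡.refl = contradiction 3≤p (ℕ.<-irrefl ≡.refl)

lookup-AllPairs : ∀ {A : Set} {R : A → A → Set} → Symmetric R → ∀ {xs} → AllPairs R xs →
                  ∀ {i j} → i ≢ j → R (lookup xs i) (lookup xs j)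
lookup-AllPairs sym (_ ∷ _)   {zero}  {zero}  i≢j = contradiction ≡.refl i≢j
lookup-AllPairs sym (Rx ∷ _)  {zero}  {suc j} i≢j = All.lookup Rx (∈-lookup j)
lookup-AllPairs sym (Rx ∷ _)  {suc i} {zero}  i≢j = sym (All.lookup Rx (∈-lookup i))
lookup-AllPairs sym (_ ∷ Rxs) {suc i} {suc j} i≢j = lookup-AllPairs sym Rxs (λ i≡j → i≢j (≡.cong suc i≡j))

geometric : ℕ → ℕ → ℕ
geometric p zero = 0
geometric p (suc k) = suc (p ℕ.* geometric p k)

odd^≡ : ∀ a k → suc (2 ℕ.* a) ℕ.^ k ≡ suc (2 ℕ.* (a ℕ.* geometric (suc (2 ℕ.* a)) k))
odd^≡ a zero = ≡.cong (λ z → suc (2 ℕ.* z)) (≡.sym (ℕ.*-zeroʳ a))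
odd^≡ a (suc k) = ≡.trans (≡.cong (suc (2 ℕ.* a) ℕ.*_) (odd^≡ a k)) (lemma a (geometric (suc (2 ℕ.* a)) k))
  where
  lemma : ∀ a g → suc (2 ℕ.* a) ℕ.* suc (2 ℕ.* (a ℕ.* g)) ≡ suc (2 ℕ.* (a ℕ.* suc (suc (2 ℕ.* a) ℕ.* g)))
  lemma = solve-∀

geometric-even : ∀ a j → ∃[ e ] geometric (suc (2 ℕ.* a)) (2 ℕ.* j) ≡ 2 ℕ.* e
geometric-even a zero = 0 , ≡.refl
geometric-even a (suc j) with e , eq ← geometric-even a j =
  suc (a ℕ.+ suc (2 ℕ.* a) ℕ.* suc (2 ℕ.* a) ℕ.* e) , (begin
    geometric p (2 ℕ.* suc j)                              ≡⟨ ≡.cong (geometric p) (ℕ.*-suc 2 j) ⟩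
    suc (p ℕ.* suc (p ℕ.* geometric p (2 ℕ.* j)))          ≡⟨ ≡.cong (λ g → suc (p ℕ.* suc (p ℕ.* g))) eq ⟩
    suc (p ℕ.* suc (p ℕ.* (2 ℕ.* e)))                      ≡⟨ lemma a e ⟩
    2 ℕ.* suc (a ℕ.+ p ℕ.* p ℕ.* e)                        ∎)
  where
  open ≡.≡-Reasoning
  p = suc (2 ℕ.* a)
  lemma : ∀ a e → suc (suc (2 ℕ.* a) ℕ.* suc (suc (2 ℕ.* a) ℕ.* (2 ℕ.* e))) ≡
                  2 ℕ.* suc (a ℕ.+ suc (2 ℕ.* a) ℕ.* suc (2 ℕ.* a) ℕ.* e)
  lemma = solve-∀

module PrimePowerField (F : Field) {n : ℕ} (F↔Fin : HasOrder F (suc n)) {p k : ℕ} (pr : Prime p)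
                       (q≡p^k : suc n ≡ p ℕ.^ k) where
  open FiniteField F F↔Fin public
  open MatrixProperties F using (2#)
  open ≡.≡-Reasoning

  cast : ℕ → Carrier
  cast m = m ˣ 1#

  p≡0 : cast p ≡ 0#
  p≡0 = characteristic p k q≡p^k

  open ElementsOfOrderP F _≟_ pr p≡0 public using (order-p-normalForm; pˣx≡0; x^n≡0⇒x≡0)

  cast-≢0 : ∀ m .{{_ : ℕ.NonZero m}} → m ℕ.< p → cast m ≢ 0#
  cast-≢0 m m<p m≡0 = bézout (coprime-Bézout (prime⇒coprime pr m<p))
    where
    multiple≡0 : ∀ x y → cast y ≡ 0# → cast (x ℕ.* y) ≡ 0#
    multiple≡0 x y y≡0 = ≡.trans (ˣ1-homo-* x y) (≡.trans (≡.cong (cast x *_) y≡0) (zeroʳ _))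
    absurd : ∀ x y x′ y′ → cast y ≡ 0# → cast y′ ≡ 0# → ¬ (1 ℕ.+ x ℕ.* y ≡ x′ ℕ.* y′)
    absurd x y x′ y′ y≡0 y′≡0 eq = 1≢0 (begin
      1#                   ≡⟨ +-identityʳ 1# ⟨
      1# + 0#              ≡⟨ ≡.cong (λ z → 1# + z) (multiple≡0 x y y≡0) ⟨
      cast (1 ℕ.+ x ℕ.* y) ≡⟨ ≡.cong cast eq ⟩
      cast (x′ ℕ.* y′)     ≡⟨ multiple≡0 x′ y′ y′≡0 ⟩
      0#                   ∎)
    bézout : ¬ Bézout.Identity 1 p m
    bézout (Bézout.+- x y eq) = absurd y m x p m≡0 p≡0 eq
    bézout (Bézout.-+ x y eq) = absurd x p y m p≡0 m≡0 eq

  cast-≢ : ∀ {i j} → i ℕ.< j → j ℕ.< p → cast i ≢ cast j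
  cast-≢ {i} {j} i<j j<p ci≡cj = cast-≢0 (j ℕ.∸ i) {{ℕ.>-nonZero (ℕ.m<n⇒0<n∸m i<j)}}
    (ℕ.≤-<-trans (ℕ.m∸n≤m j i) j<p) (begin
      cast (j ℕ.∸ i)                     ≡⟨ solve 2 (λ x y → y := (x :+ y) :- x) ≡.refl (cast i) _ ⟩
      (cast i + cast (j ℕ.∸ i)) - cast i ≡⟨ ≡.cong (_- cast i) (ˣ-homo-+ 1# i (j ℕ.∸ i)) ⟨
      cast (i ℕ.+ (j ℕ.∸ i)) - cast i    ≡⟨ ≡.cong (λ m → cast m - cast i) (ℕ.m+[n∸m]≡n (ℕ.<⇒≤ i<j)) ⟩
      cast j - cast i                    ≡⟨ ≡⇒-‿≡0 (≡.sym ci≡cj) ⟩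
      0#                                 ∎)

  cast-injective : ∀ {i j} → i ℕ.< p → j ℕ.< p → cast i ≡ cast j → i ≡ j
  cast-injective {i} {j} i<p j<p ci≡cj with ℕ.<-cmp i j
  ... | tri< i<j _ _ = contradiction ci≡cj (cast-≢ i<j j<p)
  ... | tri≈ _ i≡j _ = i≡j
  ... | tri> _ _ j<i = contradiction (≡.sym ci≡cj) (cast-≢ j<i i<p)

  ^p^j-+ : ∀ j x y → (x + y) ^ (p ℕ.^ j) ≡ x ^ (p ℕ.^ j) + y ^ (p ℕ.^ j)
  ^p^j-+ zero x y = solve 2 (λ x y → (x :+ y) :* con (+ 1) := x :* con (+ 1) :+ y :* con (+ 1)) ≡.refl x y
  ^p^j-+ (suc j) x y = begin
    (x + y) ^ (p ℕ.* P)          ≡⟨ ^-assocʳ (x + y) p P ⟨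
    ((x + y) ^ p) ^ P            ≡⟨ ≡.cong (_^ P) (Frobenius.frobenius-+ semiring pr pˣx≡0 x y (*-comm x y)) ⟩
    (x ^ p + y ^ p) ^ P          ≡⟨ ^p^j-+ j (x ^ p) (y ^ p) ⟩
    (x ^ p) ^ P + (y ^ p) ^ P    ≡⟨ ≡.cong₂ _+_ (^-assocʳ x p P) (^-assocʳ y p P) ⟩
    x ^ (p ℕ.* P) + y ^ (p ℕ.* P) ∎
    where P = p ℕ.^ j

  ^p^j-- : ∀ j x y → (x - y) ^ (p ℕ.^ j) ≡ x ^ (p ℕ.^ j) - y ^ (p ℕ.^ j)
  ^p^j-- j x y = begin
    (x - y) ^ P                    ≡⟨ solve 2 (λ a b → a := (a :+ b) :- b) ≡.refl ((x - y) ^ P) (y ^ P) ⟩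
    ((x - y) ^ P + y ^ P) - y ^ P  ≡⟨ ≡.cong (_- y ^ P) (^p^j-+ j (x - y) y) ⟨
    ((x - y) + y) ^ P - y ^ P      ≡⟨ ≡.cong (λ z → z ^ P - y ^ P) (solve 2 (λ x y → (x :- y) :+ y := x) ≡.refl x y) ⟩
    x ^ P - y ^ P                  ∎
    where P = p ℕ.^ j

  0^n≡0 : ∀ n .{{_ : ℕ.NonZero n}} → 0# ^ n ≡ 0#
  0^n≡0 (suc n) = zeroˡ _

  0^p^j≡0 : ∀ j → 0# ^ (p ℕ.^ j) ≡ 0#
  0^p^j≡0 j = 0^n≡0 (p ℕ.^ j) {{ℕ.m^n≢0 p j {{prime⇒nonZero pr}}}}

  cast-^p^j : ∀ j m → cast m ^ (p ℕ.^ j) ≡ cast m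
  cast-^p^j j zero = 0^p^j≡0 j
  cast-^p^j j (suc m) = ≡.trans (^p^j-+ j 1# (cast m)) (≡.cong₂ _+_ (1^n≡1 (p ℕ.^ j)) (cast-^p^j j m))

  x^[1+m]≡x⇒x^m≡1 : ∀ {x} m → x ≢ 0# → x ^ suc m ≡ x → x ^ m ≡ 1#
  x^[1+m]≡x⇒x^m≡1 {x} m x≢0 eq = *-cancelˡ x≢0 (≡.trans eq (≡.sym (*-identityʳ x)))

module Action (F : Field) {n : ℕ} (F↔Fin : HasOrder F (suc n)) {p k : ℕ} (pr : Prime p) (5≤p : 5 ℕ.≤ p)
              (q≡p^k : suc n ≡ p ℕ.^ k) {u : Matrices.Mat F} (u-order : Matrices.OrderPrime F u p) where
  open PrimePowerField F F↔Fin {p} {k} pr q≡p^k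
  open MatrixProperties F

  2≢0 : 2# ≢ 0#
  2≢0 2≡0 = cast-≢0 2 (ℕ.≤-trans (s≤s (s≤s (s≤s z≤n))) 5≤p)
    (≡.trans (solve 0 (con (+ 1) :+ (con (+ 1) :+ con (+ 0)) := con (+ 1) :+ con (+ 1)) ≡.refl) 2≡0)

  3≢0 : 2# + 1# ≢ 0#
  3≢0 3≡0 = cast-≢0 3 (ℕ.≤-trans (s≤s (s≤s (s≤s (s≤s z≤n)))) 5≤p)
    (≡.trans (solve 0 (con (+ 1) :+ (con (+ 1) :+ (con (+ 1) :+ con (+ 0))) := con (+ 1) :+ con (+ 1) :+ con (+ 1)) ≡.refl) 3≡0)

  open Cliques F _≟_ 2≢0 3≢0

  P : Mat
  P = proj₁ (order-p-normalForm {u} u-order)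

  c₀ : Carrier
  c₀ = proj₁ (proj₂ (order-p-normalForm {u} u-order))

  P∈SL : InSL P
  P∈SL = proj₁ (proj₂ (proj₂ (order-p-normalForm {u} u-order)))

  c₀≢0 : c₀ ≢ 0#
  c₀≢0 = proj₁ (proj₂ (proj₂ (proj₂ (order-p-normalForm {u} u-order))))

  uP≈PU : u · P ≈ P · U c₀
  uP≈PU = proj₂ (proj₂ (proj₂ (proj₂ (order-p-normalForm {u} u-order))))

  U-injective : ∀ {s t} → U s ≈ U t → s ≡ t
  U-injective (inj₁ eq) = ≡.cong Mat.b eq
  U-injective (inj₂ eq) = contradiction (begin
    1# + 1#     ≡⟨ ≡.cong (λ z → 1# + z) (≡.cong Mat.a eq) ⟩
    1# + - 1#   ≡⟨ -‿inverseʳ 1# ⟩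
    0#          ∎) 2≢0
    where open ≡.≡-Reasoning

  -- Sufficient for U s and U t to intersect: d is the diagonal entry of the conjugating element diag(d , d⁻¹).
  Linked : Carrier → Carrier → Set
  Linked s t = ∃[ i ] ∃[ d ] i ℕ.< p × d ≢ 0# × d * d * (s - t) ≡ cast i * c₀

  unitriangular-clique : ∀ {S m} → Unique S → (∀ {s t} → s ∈ S → t ∈ S → s ≢ t → Linked s t) → length S ≡ m →
                         ∃[ L ] (IsSubset L × Intersecting u p L × length L ≡ m)
  unitriangular-clique {S} S-unique linked length≡m = mapᴸ U S ,
    (All.map⁺ (All.tabulate (λ {s} _ → InSL-U s)) , AllPairs.map⁺ (AllPairs.map (λ s≢t Us≈Ut → s≢t (U-injective Us≈Ut)) S-unique)) ,
    intersecting , ≡.trans (length-map U S) length≡m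
    where
    agree : ∀ {s t} → s ∈ S → t ∈ S → Agree u p (U s) (U t)
    agree {s} {t} s∈ t∈ with s ≟ t
    ... | no s≢t with i , d , i<p , d≢0 , eq ← linked s∈ t∈ s≢t = Agree-U {u} {P} {c₀} uP≈PU P∈SL i i<p d≢0 eq
    agree {s} {t} s∈ t∈ | yes ≡.refl = Agree-U {u} {P} {c₀} uP≈PU P∈SL 0 (ℕ.≤-trans (s≤s z≤n) 5≤p) {s} {s} {1#} 1≢0
      (solve 2 (λ s c → con (+ 1) :* con (+ 1) :* (s :- s) := con (+ 0) :* c) ≡.refl s c₀)
    intersecting : Intersecting u p (mapᴸ U S)
    intersecting g∈ h∈ with ∈-map⁻ U g∈ | ∈-map⁻ U h∈
    ... | s , s∈ , ≡.refl | t , t∈ , ≡.refl = agree s∈ t∈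

  -- The parameters μ i of a clique of m elements g i = T (μ i) x y · g 0 in a translate of a Sylow p-subgroup.
  record Coordinates (m : ℕ) : Set where
    field
      x y : Carrier
      v≢0 : x ≢ 0# ⊎ y ≢ 0#
      μ : Fin m → Carrier
      μ-distinct : ∀ {i j} → i ≢ j → μ i ≢ μ j
      μ-difference : ∀ i j → ∃[ c ] ∃[ z ] ∃[ w ] (∃[ r ] c ≡ cast r * c₀) ×
                     (μ i - μ j) * x * x ≡ c * z * z × (μ i - μ j) * y * y ≡ c * w * w

  length-clique : ∀ L → IsSubset L → Intersecting u p L → length L ℕ.≤ 4 ⊎ Coordinates (length L)
  length-clique L (L∈SL , L-distinct) L-intersecting = coordinates (length L) (lookup L)
    (λ i → All.lookup L∈SL (∈-lookup i))
    (lookup-AllPairs (λ g≉h h≈g → g≉h (≈-sym h≈g)) L-distinct)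
    (λ i j → Agree⇒T {u} {P} {c₀} uP≈PU P∈SL (L-intersecting (∈-lookup i) (∈-lookup j)))
    where
    coordinates : ∀ m (g : Fin m → Mat) → (∀ i → InSL (g i)) → (∀ {i j} → i ≢ j → ¬ g i ≈ g j) →
                  (∀ i j → ∃[ r ] ∃[ x ] ∃[ y ] g i ≈ T (cast r * c₀) x y · g j) → m ℕ.≤ 4 ⊎ Coordinates m
    coordinates 0 _ _ _ _ = inj₁ z≤n
    coordinates 1 _ _ _ _ = inj₁ (s≤s z≤n)
    coordinates 2 _ _ _ _ = inj₁ (s≤s (s≤s z≤n))
    coordinates 3 _ _ _ _ = inj₁ (s≤s (s≤s (s≤s z≤n)))
    coordinates 4 _ _ _ _ = inj₁ (s≤s (s≤s (s≤s (s≤s z≤n))))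
    coordinates (suc (suc (suc (suc (suc m))))) g g∈SL g-distinct g-clique = inj₂ (record { LargeClique
      g g∈SL g-distinct (λ c → ∃[ r ] c ≡ cast r * c₀)
      (λ i j → let r , x , y , eq = g-clique i j in transvection (cast r * c₀) x y , (r , ≡.refl) , eq) })

module OddOrder (F : Field) {n : ℕ} (F↔Fin : HasOrder F (suc n)) (h : ℕ) .{{h≢0 : ℕ.NonZero h}} (h*2≡n : h ℕ.* 2 ≡ n) where
  open FiniteField F F↔Fin
  open ≡.≡-Reasoning

  abstract
    x^h≡1⇒square : ∀ {x} → x ^ h ≡ 1# → ∃[ r ] r * r ≡ x
    x^h≡1⇒square x^h≡1 with r , r²≡x ← PowerMap.x^b≡1⇒power 2 h h*2≡n x^h≡1 =
      r , ≡.trans (≡.cong (r *_) (≡.sym (*-identityʳ r))) r²≡x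

    nonsquare : ∃[ ν ] ∀ r → r * r ≢ ν
    nonsquare with any? (λ x → nonzero? x ×-dec ¬? (x ^ h ≟ 1#))
    ... | yes (ν , ν≢0 , ν^h≢1) = ν , λ r r²≡ν → ν^h≢1 (begin
          ν ^ h            ≡⟨ ≡.cong (_^ h) r²≡ν ⟨
          (r * r) ^ h      ≡⟨ ^-distrib-* r r h ⟩
          r ^ h * r ^ h    ≡⟨ ^-homo-* r h h ⟨
          r ^ (h ℕ.+ h)    ≡⟨ ≡.cong (r ^_) (≡.trans (lemma h) h*2≡n) ⟩
          r ^ n            ≡⟨ fermat (λ { ≡.refl → ν≢0 (≡.trans (≡.sym r²≡ν) (zeroˡ 0#)) }) ⟩
          1#               ∎)
      where
      lemma : ∀ h → h ℕ.+ h ≡ h ℕ.* 2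
      lemma = solve-∀
    ... | no all-roots = contradiction (ℕ.≤-trans n≤length-nonzero (length-nthRoots≤n h (Unique.filter⁺ nonzero? elements-unique)
            (All.tabulate (λ {x} x∈ → decidable-stable (x ^ h ≟ 1#)
              (λ x^h≢1 → all-roots (x , proj₂ (∈-filter⁻ nonzero? {xs = elements} x∈) , x^h≢1))))))
          (ℕ.<⇒≱ (≡.subst (h ℕ.<_) h*2≡n (ℕ.m<m*n h 2 (s≤s (s≤s z≤n)))))

module OddExponent (F : Field) {n : ℕ} (F↔Fin : HasOrder F (suc n)) {p k : ℕ} (pr : Prime p) (5≤p : 5 ℕ.≤ p)
                   (q≡p^k : suc n ≡ p ℕ.^ k) {u : Matrices.Mat F} (u-order : Matrices.OrderPrime F u p)
                   (a b′ : ℕ) .{{_ : ℕ.NonZero a}} (p≡1+2a : p ≡ suc (2 ℕ.* a))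
                   (n≡ : n ≡ 2 ℕ.* (a ℕ.* suc (2 ℕ.* b′))) where
  open PrimePowerField F F↔Fin {p} {k} pr q≡p^k
  open MatrixProperties F using (IsSubset; Intersecting; IsMaxIntersectingSize)
  open Action F F↔Fin {p} {k} pr 5≤p q≡p^k {u} u-order using (2≢0; 3≢0; c₀; c₀≢0; Linked; unitriangular-clique; length-clique; Coordinates)
  open Cliques F _≟_ 2≢0 3≢0 using (x²≡y²⇒)
  open ≡.≡-Reasoning

  private
    b h : ℕ
    b = suc (2 ℕ.* b′)
    h = a ℕ.* b
    instance
      h≢0 : ℕ.NonZero h
      h≢0 = ℕ.m*n≢0 a b
    h*2≡n : h ℕ.* 2 ≡ n
    h*2≡n = ≡.trans (ℕ.*-comm h 2) (≡.sym n≡)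

  open OddOrder F F↔Fin h h*2≡n

  ±1 : ∀ {x} → x * x ≡ 1# → x ≡ 1# ⊎ x ≡ - 1#
  ±1 x²≡1 = x²≡y²⇒ (≡.trans (*-identityˡ 1#) (≡.sym x²≡1))

  x^[m+m] : ∀ x m → x ^ m * x ^ m ≡ x ^ (2 ℕ.* m)
  x^[m+m] x m = ≡.trans (≡.sym (^-homo-* x m m)) (≡.cong (λ l → x ^ (m ℕ.+ l)) (≡.sym (ℕ.+-identityʳ m)))

  <p : ∀ (i : Fin (2 ℕ.* a)) → suc (toℕ i) ℕ.< p
  <p i = ≡.subst (suc (toℕ i) ℕ.<_) (≡.sym p≡1+2a) (s≤s (Fin.toℕ<n i))

  -- As k is odd, an element of the prime field with this property is a nonsquare in the whole field.
  abstract
    γ-exists : ∃[ i ] i ℕ.< p × cast i ≢ 0# × cast i ^ a ≢ 1#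
    γ-exists with Fin.any? {n = 2 ℕ.* a} (λ i → ¬? (cast (suc (toℕ i)) ^ a ≟ 1#))
    ... | yes (i , γ^a≢1) = suc (toℕ i) , <p i , cast-≢0 (suc (toℕ i)) (<p i) , γ^a≢1
    ... | no all-roots = contradiction
          (length-nthRoots≤n a {xs = tabulate γs} (Unique.tabulate⁺ (λ {i} {j} eq → Fin.toℕ-injective (ℕ.suc-injective (cast-injective (<p i) (<p j) eq))))
            (All.tabulate⁺ (λ i → decidable-stable (γs i ^ a ≟ 1#) (λ γ^a≢1 → all-roots (i , γ^a≢1)))))
          (ℕ.<⇒≱ (≡.subst (a ℕ.<_) (≡.trans (ℕ.*-comm a 2) (≡.sym (length-tabulate γs))) (ℕ.m<m*n a 2 (s≤s (s≤s z≤n)))))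
      where
      γs : Fin (2 ℕ.* a) → Carrier
      γs i = cast (suc (toℕ i))

  private
    i₀ : ℕ
    i₀ = proj₁ γ-exists
    γ : Carrier
    γ = cast i₀
    i₀<p = proj₁ (proj₂ γ-exists)
    γ≢0 = proj₁ (proj₂ (proj₂ γ-exists))
    γ^a≢1 = proj₂ (proj₂ (proj₂ γ-exists))

  γ^h≡-1 : γ ^ h ≡ - 1#
  γ^h≡-1 = begin
    γ ^ (a ℕ.* b)                    ≡⟨ ^-assocʳ γ a b ⟨
    (γ ^ a) ^ suc (2 ℕ.* b′)         ≡⟨ ≡.cong (_^ suc (2 ℕ.* b′)) γ^a≡-1 ⟩
    - 1# * (- 1#) ^ (2 ℕ.* b′)       ≡⟨ ≡.cong (- 1# *_) (≡.trans (≡.sym (^-assocʳ (- 1#) 2 b′))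
                                          (≡.trans (≡.cong (_^ b′) [-1]²≡1) (1^n≡1 b′))) ⟩
    - 1# * 1#                        ≡⟨ *-identityʳ _ ⟩
    - 1#                             ∎
    where
    [-1]²≡1 : (- 1#) ^ 2 ≡ 1#
    [-1]²≡1 = solve 0 (:- con (+ 1) :* (:- con (+ 1) :* con (+ 1)) := con (+ 1)) ≡.refl
    γ^[p-1]≡1 : γ ^ (2 ℕ.* a) ≡ 1#
    γ^[p-1]≡1 = x^[1+m]≡x⇒x^m≡1 (2 ℕ.* a) γ≢0 (≡.trans
      (≡.cong (γ ^_) (≡.trans (≡.sym p≡1+2a) (≡.sym (ℕ.*-identityʳ p)))) (cast-^p^j 1 i₀))
    γ^a≡-1 : γ ^ a ≡ - 1#
    γ^a≡-1 = [ (λ γ^a≡1 → contradiction γ^a≡1 γ^a≢1) , (λ eq → eq) ]′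
      (±1 (≡.trans (x^[m+m] γ a) γ^[p-1]≡1))

  square-class : ∀ {w} → w ≢ 0# → ∃[ i ] ∃[ d ] i ℕ.< p × d ≢ 0# × d * d ≡ cast i * w
  square-class {w} w≢0 = [ square , nonsquare-case ]′
    (±1 (≡.trans (x^[m+m] w h) (≡.trans (≡.cong (w ^_) (≡.sym n≡)) (fermat w≢0))))
    where
    square : w ^ h ≡ 1# → _
    square w^h≡1 = let d , d²≡w = x^h≡1⇒square w^h≡1 in
      1 , d , ℕ.≤-trans (s≤s (s≤s z≤n)) 5≤p , x²≢0⇒x≢0 d²≡w w≢0 ,
      ≡.trans d²≡w (solve 1 (λ w → w := (con (+ 1) :+ con (+ 0)) :* w) ≡.refl w)
    nonsquare-case : w ^ h ≡ - 1# → _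
    nonsquare-case w^h≡-1 = let d , d²≡γw = x^h≡1⇒square [γw]^h≡1 in
      i₀ , d , i₀<p , x²≢0⇒x≢0 d²≡γw (*-≢0 γ≢0 w≢0) , d²≡γw
      where
      [γw]^h≡1 : (γ * w) ^ h ≡ 1#
      [γw]^h≡1 = begin
        (γ * w) ^ h      ≡⟨ ^-distrib-* γ w h ⟩
        γ ^ h * w ^ h    ≡⟨ ≡.cong₂ _*_ γ^h≡-1 w^h≡-1 ⟩
        - 1# * - 1#      ≡⟨ solve 0 (:- con (+ 1) :* :- con (+ 1) := con (+ 1)) ≡.refl ⟩
        1#               ∎

  linked : ∀ {s t} → s ≢ t → Linked s t
  linked {s} {t} s≢t =
    let w , δw≡1 = inverse (s - t) (λ s-t≡0 → s≢t (-‿≡0⇒≡ s-t≡0))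
        i , d , i<p , d≢0 , d²≡ = square-class {w * c₀} (*-≢0 (xy≡1⇒y≢0 δw≡1) c₀≢0)
    in i , d , i<p , d≢0 , (begin
      d * d * (s - t)                  ≡⟨ ≡.cong (_* (s - t)) d²≡ ⟩
      cast i * (w * c₀) * (s - t)      ≡⟨ solve 4 (λ i w c δ → i :* (w :* c) :* δ := δ :* w :* (i :* c)) ≡.refl (cast i) w c₀ (s - t) ⟩
      (s - t) * w * (cast i * c₀)      ≡⟨ ≡.cong (_* (cast i * c₀)) δw≡1 ⟩
      1# * (cast i * c₀)               ≡⟨ *-identityˡ _ ⟩
      cast i * c₀                      ∎)

  m≤q : ∀ {m} → Coordinates m → m ℕ.≤ suc n
  m≤q coords = Fin.injective⇒≤ {f = λ i → index (μ i)} (λ {i} {j} eq →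
    decidable-stable (i Fin.≟ j) (λ i≢j → μ-distinct i≢j (index-injective eq)))
    where open Coordinates coords

  maximum : 4 ℕ.≤ suc n → IsMaxIntersectingSize u p (suc n)
  maximum 4≤q = unitriangular-clique elements-unique (λ _ _ → linked) (length-tabulate element) ,
    λ L L-subset L-intersecting →
      [ (λ ≤4 → ℕ.≤-trans ≤4 4≤q) , m≤q ]′ (length-clique L L-subset L-intersecting)

module EvenExponent (F : Field) {n : ℕ} (F↔Fin : HasOrder F (suc n)) {p k : ℕ} (pr : Prime p) (5≤p : 5 ℕ.≤ p)
                    (q≡p^k : suc n ≡ p ℕ.^ k) {u : Matrices.Mat F} (u-order : Matrices.OrderPrime F u p)
                    (j t : ℕ) .{{_ : ℕ.NonZero t}} (√q≡1+2t : p ℕ.^ j ≡ suc (2 ℕ.* t))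
                    (q≡√q*√q : suc n ≡ p ℕ.^ j ℕ.* p ℕ.^ j) where
  open PrimePowerField F F↔Fin {p} {k} pr q≡p^k
  open MatrixProperties F using (IsSubset; Intersecting; IsMaxIntersectingSize)
  open Action F F↔Fin {p} {k} pr 5≤p q≡p^k {u} u-order using (c₀; c₀≢0; Linked; unitriangular-clique; length-clique; Coordinates)
  open ≡.≡-Reasoning

  private
    √q h : ℕ
    √q = p ℕ.^ j
    h = t ℕ.* (2 ℕ.* suc t)
    instance
      h≢0 : ℕ.NonZero h
      h≢0 = ℕ.m*n≢0 t (2 ℕ.* suc t)
      2t≢0 : ℕ.NonZero (2 ℕ.* t)
      2t≢0 = ℕ.m*n≢0 2 t
    n≡ : 2 ℕ.* t ℕ.* (2 ℕ.* suc t) ≡ n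
    n≡ = ℕ.suc-injective (begin
      suc (2 ℕ.* t ℕ.* (2 ℕ.* suc t))       ≡⟨ lemma t ⟩
      suc (2 ℕ.* t) ℕ.* suc (2 ℕ.* t)       ≡⟨ ≡.cong₂ ℕ._*_ √q≡1+2t √q≡1+2t ⟨
      √q ℕ.* √q                             ≡⟨ q≡√q*√q ⟨
      suc n                                 ∎)
      where
      lemma : ∀ t → suc (2 ℕ.* t ℕ.* (2 ℕ.* suc t)) ≡ suc (2 ℕ.* t) ℕ.* suc (2 ℕ.* t)
      lemma = solve-∀
    h*2≡n : h ℕ.* 2 ≡ n
    h*2≡n = ≡.trans (lemma t) n≡
      where
      lemma : ∀ t → t ℕ.* (2 ℕ.* suc t) ℕ.* 2 ≡ 2 ℕ.* t ℕ.* (2 ℕ.* suc t)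
      lemma = solve-∀

  open OddOrder F F↔Fin h h*2≡n
  open PowerMap (2 ℕ.* suc t) (2 ℕ.* t) n≡ using (rootsOfUnity; rootsOfUnity-unique; rootsOfUnity-all; length-rootsOfUnity)

  fixed⇒square : ∀ {x} → x ^ √q ≡ x → ∃[ r ] r * r ≡ x
  fixed⇒square {x} x^√q≡x with x ≟ 0#
  ... | yes ≡.refl = 0# , zeroˡ 0#
  ... | no x≢0 = x^h≡1⇒square (begin
      x ^ (t ℕ.* (2 ℕ.* suc t))       ≡⟨ ≡.cong (x ^_) (lemma t) ⟩
      x ^ (2 ℕ.* t ℕ.* suc t)         ≡⟨ ^-assocʳ x (2 ℕ.* t) (suc t) ⟨
      (x ^ (2 ℕ.* t)) ^ suc t         ≡⟨ ≡.cong (_^ suc t) (x^[1+m]≡x⇒x^m≡1 (2 ℕ.* t) x≢0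
                                           (≡.trans (≡.cong (x ^_) (≡.sym √q≡1+2t)) x^√q≡x)) ⟩
      1# ^ suc t                      ≡⟨ 1^n≡1 (suc t) ⟩
      1#                              ∎)
    where
    lemma : ∀ t → t ℕ.* (2 ℕ.* suc t) ≡ 2 ℕ.* t ℕ.* suc t
    lemma = solve-∀

  subfield : List Carrier
  subfield = 0# ∷ rootsOfUnity

  subfield-unique : Unique subfield
  subfield-unique = All.map (λ { {x} x^≡1 ≡.refl → 0≢1 (≡.trans (≡.sym (0^n≡0 (2 ℕ.* t))) x^≡1) }) rootsOfUnity-all
                    ∷ rootsOfUnity-unique

  subfield-fixed : ∀ {x} → x ∈ subfield → x ^ √q ≡ x
  subfield-fixed (here ≡.refl) = 0^p^j≡0 j
  subfield-fixed {x} (there x∈) = begin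
    x ^ √q               ≡⟨ ≡.cong (x ^_) √q≡1+2t ⟩
    x * x ^ (2 ℕ.* t)    ≡⟨ ≡.cong (x *_) (All.lookup rootsOfUnity-all x∈) ⟩
    x * 1#               ≡⟨ *-identityʳ x ⟩
    x                    ∎

  linked : ∀ {κ λ′} → κ ∈ subfield → λ′ ∈ subfield → κ ≢ λ′ → Linked (c₀ * κ) (c₀ * λ′)
  linked {κ} {λ′} κ∈ λ∈ κ≢λ =
    let r , r²≡κ-λ = fixed⇒square (≡.trans (^p^j-- j κ λ′) (≡.cong₂ _-_ (subfield-fixed κ∈) (subfield-fixed λ∈)))
        d , rd≡1 = inverse r (x²≢0⇒x≢0 r²≡κ-λ (λ κ-λ≡0 → κ≢λ (-‿≡0⇒≡ κ-λ≡0)))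
    in 1 , d , ℕ.≤-trans (s≤s (s≤s z≤n)) 5≤p , xy≡1⇒y≢0 rd≡1 , (begin
      d * d * (c₀ * κ - c₀ * λ′)
        ≡⟨ solve 4 (λ d c κ l → d :* d :* (c :* κ :- c :* l) := d :* d :* c :* (κ :- l)) ≡.refl d c₀ κ λ′ ⟩
      d * d * c₀ * (κ - λ′)
        ≡⟨ ≡.cong (d * d * c₀ *_) r²≡κ-λ ⟨
      d * d * c₀ * (r * r)
        ≡⟨ solve 3 (λ d c r → d :* d :* c :* (r :* r) := (r :* d) :* (r :* d) :* c) ≡.refl d c₀ r ⟩
      r * d * (r * d) * c₀
        ≡⟨ ≡.cong (λ z → z * z * c₀) rd≡1 ⟩
      1# * 1# * c₀
        ≡⟨ solve 1 (λ c → con (+ 1) :* con (+ 1) :* c := (con (+ 1) :+ con (+ 0)) :* c) ≡.refl c₀ ⟩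
      cast 1 * c₀ ∎)

  private
    ν : Carrier
    ν = proj₁ nonsquare

  s²≡νs′²⇒s′≡0 : ∀ {s s′} → s * s ≡ ν * (s′ * s′) → s′ ≡ 0#
  s²≡νs′²⇒s′≡0 {s} {s′} s²≡νs′² = decidable-stable (s′ ≟ 0#) λ s′≢0 →
    let w , s′w≡1 = inverse s′ s′≢0 in proj₂ nonsquare (s * w) (begin
      s * w * (s * w)            ≡⟨ solve 2 (λ s w → s :* w :* (s :* w) := s :* s :* (w :* w)) ≡.refl s w ⟩
      s * s * (w * w)            ≡⟨ ≡.cong (_* (w * w)) s²≡νs′² ⟩
      ν * (s′ * s′) * (w * w)    ≡⟨ solve 3 (λ n s w → n :* (s :* s) :* (w :* w) := n :* (s :* w :* (s :* w))) ≡.refl ν s′ w ⟩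
      ν * (s′ * w * (s′ * w))    ≡⟨ ≡.cong (λ e → ν * (e * e)) s′w≡1 ⟩
      ν * (1# * 1#)              ≡⟨ solve 1 (λ n → n :* (con (+ 1) :* con (+ 1)) := n) ≡.refl ν ⟩
      ν                          ∎)

  ν-combination-injective : ∀ {a a′ b b′ s s′} → a - a′ ≡ c₀ * (s * s) → b′ - b ≡ c₀ * (s′ * s′) →
                            a + ν * b ≡ a′ + ν * b′ → a ≡ a′ × b ≡ b′
  ν-combination-injective {a} {a′} {b} {b′} {s} {s′} a-a′ b′-b eq =
    -‿≡0⇒≡ (begin
      a - a′                   ≡⟨ a-a′ ⟩
      c₀ * (s * s)             ≡⟨ ≡.cong (c₀ *_) s²≡νs′² ⟩
      c₀ * (ν * (s′ * s′))     ≡⟨ ≡.cong (λ e → c₀ * (ν * (e * e))) s′≡0 ⟩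
      c₀ * (ν * (0# * 0#))     ≡⟨ solve 2 (λ c n → c :* (n :* (con (+ 0) :* con (+ 0))) := con (+ 0)) ≡.refl c₀ ν ⟩
      0#                       ∎) ,
    ≡.sym (-‿≡0⇒≡ (begin
      b′ - b              ≡⟨ b′-b ⟩
      c₀ * (s′ * s′)      ≡⟨ ≡.cong (λ e → c₀ * (e * e)) s′≡0 ⟩
      c₀ * (0# * 0#)      ≡⟨ solve 1 (λ c → c :* (con (+ 0) :* con (+ 0)) := con (+ 0)) ≡.refl c₀ ⟩
      0#                  ∎))
    where
    s²≡νs′² : s * s ≡ ν * (s′ * s′)
    s²≡νs′² = *-cancelˡ c₀≢0 (begin
      c₀ * (s * s)               ≡⟨ a-a′ ⟨
      a - a′                     ≡⟨ solve 4 (λ a a′ b b′ → a :- a′ := ((a :+ b) :- (a′ :+ b′)) :+ (b′ :- b)) ≡.refl a a′ (ν * b) (ν * b′) ⟩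
      ((a + ν * b) - (a′ + ν * b′)) + (ν * b′ - ν * b)
                                 ≡⟨ ≡.cong (λ z → z + (ν * b′ - ν * b)) (≡⇒-‿≡0 eq) ⟩
      0# + (ν * b′ - ν * b)      ≡⟨ solve 3 (λ n b b′ → con (+ 0) :+ (n :* b′ :- n :* b) := n :* (b′ :- b)) ≡.refl ν b b′ ⟩
      ν * (b′ - b)               ≡⟨ ≡.cong (ν *_) b′-b ⟩
      ν * (c₀ * (s′ * s′))       ≡⟨ solve 3 (λ n c s → n :* (c :* s) := c :* (n :* s)) ≡.refl ν c₀ (s′ * s′) ⟩
      c₀ * (ν * (s′ * s′))       ∎)
    s′≡0 : s′ ≡ 0#
    s′≡0 = s²≡νs′²⇒s′≡0 s²≡νs′²

  module _ {m} (coords : Coordinates m) where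
    open Coordinates coords

    private
      square-ratio : ∀ {δ c z v r} → v ≢ 0# → r * r ≡ cast c → δ * v * v ≡ cast c * c₀ * z * z → ∃[ s ] δ ≡ c₀ * (s * s)
      square-ratio {δ} {c} {z} {v} {r} v≢0 r²≡c eq with w , vw≡1 ← inverse v v≢0 = r * z * w , (begin
        δ                                ≡⟨ solve 1 (λ δ → δ := δ :* (con (+ 1) :* con (+ 1))) ≡.refl δ ⟩
        δ * (1# * 1#)                    ≡⟨ ≡.cong (λ e → δ * (e * e)) vw≡1 ⟨
        δ * (v * w * (v * w))            ≡⟨ solve 3 (λ δ v w → δ :* (v :* w :* (v :* w)) := δ :* v :* v :* (w :* w)) ≡.refl δ v w ⟩
        δ * v * v * (w * w)              ≡⟨ ≡.cong (_* (w * w)) eq ⟩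
        cast c * c₀ * z * z * (w * w)    ≡⟨ ≡.cong (λ e → e * c₀ * z * z * (w * w)) r²≡c ⟨
        r * r * c₀ * z * z * (w * w)     ≡⟨ solve 4 (λ r c z w → r :* r :* c :* z :* z :* (w :* w) :=
                                              c :* (r :* z :* w :* (r :* z :* w))) ≡.refl r c₀ z w ⟩
        c₀ * (r * z * w * (r * z * w))   ∎)

    μ-difference-square : ∀ i j → ∃[ s ] μ i - μ j ≡ c₀ * (s * s)
    μ-difference-square i j′ with c , z , w , (m , ≡.refl) , eqx , eqy ← μ-difference i j′
      with r , r²≡c ← fixed⇒square (cast-^p^j j m) | v≢0
    ... | inj₁ x≢0 = square-ratio {c = m} {r = r} x≢0 r²≡c eqx
    ... | inj₂ y≢0 = square-ratio {c = m} {r = r} y≢0 r²≡c eqy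

    m²≤q : m ℕ.* m ℕ.≤ suc n
    m²≤q = Fin.injective⇒≤ {f = λ i → index (f (remQuot {m} m i))} (λ {i} {i′} eq →
      ≡.trans (≡.sym (Fin.combine-remQuot {m} m i)) (≡.trans (f-injective (index-injective eq)) (Fin.combine-remQuot {m} m i′)))
      where
      f : Fin m × Fin m → Carrier
      f (i , j) = μ i + ν * μ j
      μ-injective : ∀ {i j} → μ i ≡ μ j → i ≡ j
      μ-injective {i} {j} μi≡μj = decidable-stable (i Fin.≟ j) (λ i≢j → μ-distinct i≢j μi≡μj)
      f-injective : ∀ {ij ij′ : Fin m × Fin m} → f ij ≡ f ij′ →
                    combine (proj₁ ij) (proj₂ ij) ≡ combine (proj₁ ij′) (proj₂ ij′)
      f-injective {i , j} {i′ , j′} eq =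
        let s , μi-μi′ = μ-difference-square i i′
            s′ , μj′-μj = μ-difference-square j′ j
            μi≡μi′ , μj≡μj′ = ν-combination-injective μi-μi′ μj′-μj eq
        in ≡.cong₂ combine (μ-injective μi≡μi′) (μ-injective μj≡μj′)

  m≤√q : ∀ {m} → Coordinates m → m ℕ.≤ √q
  m≤√q {m} coords = ℕ.≮⇒≥ (λ √q<m → ℕ.<⇒≱ (ℕ.*-mono-< √q<m √q<m) (≡.subst (m ℕ.* m ℕ.≤_) q≡√q*√q (m²≤q coords)))

  maximum : 4 ℕ.≤ √q → IsMaxIntersectingSize u p √q
  maximum 4≤√q = unitriangular-clique (Unique.map⁺ (*-cancelˡ c₀≢0) subfield-unique) linked′
      (≡.trans (length-map (c₀ *_) subfield) (≡.trans (≡.cong suc length-rootsOfUnity) (≡.sym √q≡1+2t))) ,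
    λ L L-subset L-intersecting → [ (λ ≤4 → ℕ.≤-trans ≤4 4≤√q) , m≤√q ]′ (length-clique L L-subset L-intersecting)
    where
    linked′ : ∀ {s t} → s ∈ mapᴸ (c₀ *_) subfield → t ∈ mapᴸ (c₀ *_) subfield → s ≢ t → Linked s t
    linked′ s∈ t∈ s≢t with ∈-map⁻ (c₀ *_) s∈ | ∈-map⁻ (c₀ *_) t∈
    ... | κ , κ∈ , ≡.refl | λ′ , λ∈ , ≡.refl = linked κ∈ λ∈ (λ κ≡λ → s≢t (≡.cong (c₀ *_) κ≡λ))

open import Data.Nat using (_≤_; _+_; _*_; _^_)

maximum-oddExponent : ∀ {p} j → Prime p → 5 ≤ p → (F : Field) → HasOrder F (p ^ suc (2 * j)) →
                      ∀ u → Matrices.OrderPrime F u p → Matrices.IsMaxIntersectingSize F u p (p ^ suc (2 * j))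
maximum-oddExponent {p} j pr 5≤p F F↔Fin u u-order
  with a , ≡.refl ← prime≥3⇒odd pr (ℕ.≤-trans (s≤s (s≤s (s≤s z≤n))) 5≤p)
  with e , geometric≡2e ← geometric-even a j
  = ≡.subst (Matrices.IsMaxIntersectingSize F u p) 1+n≡q
      (OddExponent.maximum F (≡.subst (HasOrder F) (≡.sym 1+n≡q) F↔Fin) {p} {suc (2 * j)} pr 5≤p 1+n≡q {u} u-order
        a (p * e) ≡.refl n≡ (≡.subst (4 ≤_) (≡.sym 1+n≡q) 4≤q))
  where
  open ≡.≡-Reasoning
  instance
    a≢0 : ℕ.NonZero a
    a≢0 = ℕ.≢-nonZero (λ { ≡.refl → contradiction 5≤p (ℕ.<⇒≱ (s≤s (s≤s z≤n))) })
  n = 2 * (a * suc (2 * (p * e)))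
  n≡ : n ≡ 2 * (a * suc (2 * (p * e)))
  n≡ = ≡.refl
  1+n≡q : suc n ≡ p ^ suc (2 * j)
  1+n≡q = begin
    suc (2 * (a * suc (2 * (p * e))))                   ≡⟨ ≡.cong (λ z → suc (2 * (a * suc z))) (lemma p e) ⟩
    suc (2 * (a * suc (p * (2 * e))))                   ≡⟨ ≡.cong (λ z → suc (2 * (a * suc (p * z)))) geometric≡2e ⟨
    suc (2 * (a * geometric p (suc (2 * j))))           ≡⟨ odd^≡ a (suc (2 * j)) ⟨
    p ^ suc (2 * j)                                     ∎
    where
    lemma : ∀ p e → 2 * (p * e) ≡ p * (2 * e)
    lemma = solve-∀
  4≤q : 4 ≤ p ^ suc (2 * j)
  4≤q = ℕ.≤-trans (ℕ.≤-trans (ℕ.n≤1+n 4) 5≤p) (ℕ.m≤m*n p (p ^ (2 * j)) {{ℕ.m^n≢0 p (2 * j)}})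

maximum-evenExponent : ∀ {p} j → .{{ℕ.NonZero j}} → Prime p → 5 ≤ p → (F : Field) → HasOrder F (p ^ (2 * j)) →
                       ∀ u → Matrices.OrderPrime F u p → Matrices.IsMaxIntersectingSize F u p (p ^ j)
maximum-evenExponent {p} j@(suc j-1) pr 5≤p F F↔Fin u u-order
  with a , ≡.refl ← prime≥3⇒odd pr (ℕ.≤-trans (s≤s (s≤s (s≤s z≤n))) 5≤p)
  = EvenExponent.maximum F (≡.subst (HasOrder F) (≡.sym 1+n≡q) F↔Fin) {p} {2 * j} pr 5≤p 1+n≡q {u} u-order
      j (a * geometric p j) {{ℕ.m*n≢0 a (geometric p j)}} (odd^≡ a j) (≡.trans 1+n≡q q≡√q*√q) 4≤√q
  where
  instance
    a≢0 : ℕ.NonZero a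
    a≢0 = ℕ.≢-nonZero (λ { ≡.refl → contradiction 5≤p (ℕ.<⇒≱ (s≤s (s≤s z≤n))) })
  1+n≡q : suc (2 * (a * geometric p (2 * j))) ≡ p ^ (2 * j)
  1+n≡q = ≡.sym (odd^≡ a (2 * j))
  q≡√q*√q : p ^ (2 * j) ≡ p ^ j * p ^ j
  q≡√q*√q = ≡.trans (≡.cong (λ l → p ^ (j + l)) (ℕ.+-identityʳ j)) (ℕ.^-distribˡ-+-* p j j)
  4≤√q : 4 ≤ p ^ j
  4≤√q = ℕ.≤-trans (ℕ.≤-trans (ℕ.n≤1+n 4) 5≤p) (ℕ.m≤m*n p (p ^ j-1) {{ℕ.m^n≢0 p j-1}})

theorem1p3 : (p k : ℕ) → Prime p → 5 ≤ p → 1 ≤ k →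
    (F : Field) → HasOrder F (p ^ k) →
    (u : Matrices.Mat F) → Matrices.OrderPrime F u p →
    Σ ℕ λ m → Matrices.IsMaxIntersectingSize F u p m ×
    ((∀ j → k ≡ suc (2 * j) → mkℚᵘ (+ m) (p ∸ 1) ≃ mkℚᵘ (+ (p ^ k)) (p ∸ 1)) ×
    (∀ j → k ≡ 2 * j → mkℚᵘ (+ m) (p ∸ 1) ≃ mkℚᵘ (+ (p ^ j)) (p ∸ 1)))
theorem1p3 p k pr 5≤p 1≤k F F↔Fin u u-order with even⊎odd k
... | inj₂ (j , ≡.refl) = p ^ suc (2 * j) , maximum-oddExponent j pr 5≤p F F↔Fin u u-order ,
      (λ _ _ → ℚᵘ.≃-refl) , (λ i odd≡even → contradiction (≡.sym odd≡even) (ℕ.even≢odd i j))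
... | inj₁ (j@(suc _) , ≡.refl) = p ^ j , maximum-evenExponent j pr 5≤p F F↔Fin u u-order ,
      (λ i even≡odd → contradiction even≡odd (ℕ.even≢odd j i)) ,
      (λ i 2j≡2i → ℚᵘ.≃-reflexive (≡.cong (λ l → mkℚᵘ (+ (p ^ l)) (p ∸ 1)) (ℕ.*-cancelˡ-≡ j i 2 2j≡2i)))
theorem1p3 p k pr 5≤p () F F↔Fin u u-order | inj₁ (zero , ≡.refl)
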